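{- There exists an integer $N$ such that for all $n \ge N$ and all nonnegative integers $k \neq 4$, we have $P_{n,M}(4) > P_{n,M}(k)$, where $P_{n,M}(k) := P(2n-1-|S-S| = k)$ for $S$ a uniformly random subset of $[n]=\{0,1,\dots,n-1\}$.
   Context: For a positive integer $n$, $[n] := \{0,1,\dots,n-1\}$, and $S$ is chosen uniformly at random among all $2^n$ subsets of $[n]$. The difference set is $S-S := \{x-y : x,y \in S\}$. Note $|S-S| \le 2n-1$, so $2n-1-|S-S|$ is the number of elements of $\{ -(n-1),\dots,n-1\}$ missing from $S-S$. -}

module Defs where

open import Data.Bool using (Bool; true; false)
open import Data.Nat using (ℕ; zero; suc; _+_; _*_; _∸_)
import Data.Nat as ℕ
open import Data.Integer using (ℤ; +_; _-_)
import Data.Integer as ℤ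
open import Data.Fin using (Fin; toℕ)
open import Data.Fin.Subset using (Subset; _∈_)
open import Data.Fin.Subset.Properties using (_∈?_)
open import Data.List using (List; []; _∷_; map; filter; length; allFin; cartesianProductWith; _++_; deduplicate)
open import Data.Vec using (Vec; []; _∷_)
open import Relation.Nullary.Decidable using (⌊_⌋)

allSubsets : (n : ℕ) → List (Subset n)
allSubsets zero    = [] ∷ []
allSubsets (suc n) = map (true ∷_) (allSubsets n) ++ map (false ∷_) (allSubsets n)

elems : {n : ℕ} → Subset n → List ℤ
elems {n} S = map (λ (x : Fin n) → + toℕ x) (filter (_∈? S) (allFin n))

diffSet : {n : ℕ} → Subset n → List ℤ
diffSet S = deduplicate ℤ._≟_ (cartesianProductWith _-_ (elems S) (elems S))

diffCard : {n : ℕ} → Subset n → ℕ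
diffCard S = length (diffSet S)

-- 2n - 1 - |S - S|  (number of missing differences; |S-S| ≤ 2n-1 so ∸ is exact)
missing : {n : ℕ} → Subset n → ℕ
missing {n} S = 2 * n ∸ 1 ∸ diffCard S

-- 2^n · P_{n,M}(k) = #{S ⊆ [n] : 2n - 1 - |S - S| = k}
countM : (n k : ℕ) → ℕ
countM n k = length (filter (λ S → missing S ℕ.≟ k) (allSubsets n))

{-# OPTIONS --safe #-}
module Submission where

open import Defs
open import Data.Nat using (ℕ; _≥_; _>_)
open import Relation.Binary.PropositionalEquality using (_≢_)
open import Data.Product using (∃-syntax)

open import Data.Bool using (Bool; true; false; _∧_; _∨_; not; if_then_else_; T)
open import Data.Bool.Properties using (∨-assoc; ∨-identityʳ; ∨-zeroʳ; ∧-zeroʳ) renaming (_≟_ to _≟ᵇ_)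
open import Data.Fin using (zero; suc; toℕ; fromℕ<)
open import Data.Fin.Properties using (toℕ-fromℕ<)
open import Data.Fin.Subset using (Subset)
import Data.Fin.Subset as Subset
open import Data.Fin.Subset.Properties using (_∈?_)
open import Data.Integer using (ℤ; -[1+_]) renaming (+_ to pos)
import Data.Integer as ℤ
import Data.Integer.Properties as ℤ
open import Data.List using (List; []; _∷_; _++_; _∷ʳ_; length; reverse; replicate; map; filter; allFin; upTo; applyUpTo; cartesianProductWith)
open import Data.List.Properties using (unfold-reverse; reverse-++; reverse-involutive; ++-assoc; ++-identityʳ; length-++; length-map; length-reverse; length-replicate; filter-++)
open import Data.List.Membership.Propositional using (_∈_)
open import Data.List.Membership.Propositional.Properties
  using (∈-++⁺ʳ; ∈-++⁺ˡ; ∈-++⁻; ∈-allFin; ∈-cartesianProductWith⁺; ∈-cartesianProductWith⁻; ∈-deduplicate⁺; ∈-deduplicate⁻; ∈-filter⁺; ∈-filter⁻; ∈-map⁺; ∈-map⁻; ∈-upTo⁺)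
open import Data.List.Membership.Propositional.Properties.WithK using (unique∧set⇒bag)
open import Data.List.Relation.Binary.BagAndSetEquality using (∼bag⇒↭)
open import Data.List.Relation.Binary.Permutation.Propositional.Properties using (↭-length)
open import Data.List.Relation.Unary.All using (tabulate)
open import Data.List.Relation.Unary.Any using (here; there)
open import Data.List.Relation.Unary.Unique.Propositional using (Unique; _∷_)
import Data.List.Relation.Unary.Unique.Propositional.Properties as Unique
open import Data.List.Relation.Unary.Unique.DecPropositional.Properties ℤ._≟_ using (deduplicate-!)
open import Data.Nat hiding (_≥_; _>_; ℕ; compare)
open import Data.Nat.DivMod using (_/_; _%_; m≡m%n+[m/n]*n; m%n<n; /-mono-≤)
open import Data.Nat.Properties
open import Data.Nat.Tactic.RingSolver using (solve-∀)
open import Data.Product using (_×_; _,_; proj₁; proj₂)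
open import Data.Sum using (_⊎_; inj₁; inj₂)
open import Data.Vec using ([]; _∷_; toList; here; there)
open import Data.Vec.Properties using (length-toList)
open import Function using (_∘_)
open import Function.Bundles using (mk⇔)
open import Relation.Binary.Definitions using (tri<; tri≈; tri>)
open import Relation.Binary.PropositionalEquality hiding (_≢_)
open import Relation.Nullary using (¬_; Dec; yes; no; contradiction)

-- For S ≠ ∅ the number of missing differences is 2 μ(S), where μ(S) counts the missing positive
-- ones, so the claim is that μ = 2 is the most likely value. Reading S from the left as A and from
-- the right as B, the difference n − 1 − i is missing iff i ∉ A + B. Up to an exponentially small
-- probability all i ≥ g ≈ n / 4 are in A + B, and then μ = min A + min B + r, where r is the number
-- of integers missing from the sum of A − min A and B − min B. As min A and min B are geometric,
-- P(μ = m) = Σ_j (j + 1) / 2 ^ (j + 2) · P(r = m − j), and the claim reduces to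
-- 4 P(r = 2) > P(r = 0) for m = 0, 1 and 4 P(r ≤ 2) + P(r ≤ 1) > 4 for m ≥ 3.
-- Both are verified by evaluating a branching procedure that reveals A and B bit by bit and
-- stops at prefixes for which a union bound shows that later integers are unlikely to be missing.

-- Sums over all Boolean words of a given length

-- With the weights 16 (j + 1) / 2 ^ (j + 2) = 4, 4, 3, 2, ... one gets, up to the small error, 16
-- (P(μ = 2) - P(μ = 1)) = 4 P(r = 2) - P(r = 0); the inequality for m ≥ 3 arises likewise by
-- comparing the coefficients of P(r = 0), P(r = 1), .... The obstacle is that the first margin is
-- thin, so the distribution of r has to be known rather precisely. It is computable because a late
-- integer is missing only if many disjoint pairs of bits all avoid (1, 1), at a cost of 3/4 per
-- pair; the tail of the union bound is then a geometric series with an explicit sum. One finite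
-- evaluation thus covers all word lengths h ≥ 16 with a fixed margin 2 ^ -12. What is left is that
-- the error, of order g (3/4) ^ g, falls below this margin; that decides how large n has to be. The
-- evaluation yields upper bounds only, so both inequalities are rewritten in terms of complementary
-- events. Probabilities appear as numbers of words, with all denominators cleared.

+-interchange : ∀ a b c d → (a + b) + (c + d) ≡ (a + c) + (b + d)
+-interchange = solve-∀

opaque
  ∑ : ℕ → (List Bool → ℕ) → ℕ
  ∑ zero    F = F []
  ∑ (suc n) F = ∑ n (F ∘ (true ∷_)) + ∑ n (F ∘ (false ∷_))

∑∑ : ℕ → (List Bool → List Bool → ℕ) → ℕ
∑∑ n F = ∑ n (λ u → ∑ n (F u))

opaque
  unfolding ∑

  ∑-zero : ∀ (F : List Bool → ℕ) → ∑ 0 F ≡ F []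
  ∑-zero F = refl

  ∑-suc : ∀ n (F : List Bool → ℕ) → ∑ (suc n) F ≡ ∑ n (F ∘ (true ∷_)) + ∑ n (F ∘ (false ∷_))
  ∑-suc n F = refl

  ∑-mono : ∀ n {F G : List Bool → ℕ} → (∀ v → length v ≡ n → F v ≤ G v) → ∑ n F ≤ ∑ n G
  ∑-mono zero    F≤G = F≤G [] refl
  ∑-mono (suc n) F≤G = +-mono-≤ (∑-mono n λ v e → F≤G (true ∷ v) (cong suc e))
                                (∑-mono n λ v e → F≤G (false ∷ v) (cong suc e))

  ∑-cong : ∀ n {F G : List Bool → ℕ} → (∀ v → length v ≡ n → F v ≡ G v) → ∑ n F ≡ ∑ n G
  ∑-cong zero    F≡G = F≡G [] refl
  ∑-cong (suc n) F≡G = cong₂ _+_ (∑-cong n λ v e → F≡G (true ∷ v) (cong suc e))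
                                 (∑-cong n λ v e → F≡G (false ∷ v) (cong suc e))

  ∑-+ : ∀ n (F G : List Bool → ℕ) → ∑ n (λ v → F v + G v) ≡ ∑ n F + ∑ n G
  ∑-+ zero    F G = refl
  ∑-+ (suc n) F G = trans (cong₂ _+_ (∑-+ n _ _) (∑-+ n _ _)) (+-interchange (∑ n (F ∘ (true ∷_))) _ _ _)

  ∑-*ˡ : ∀ n c (F : List Bool → ℕ) → ∑ n (λ v → c * F v) ≡ c * ∑ n F
  ∑-*ˡ zero    c F = refl
  ∑-*ˡ (suc n) c F = trans (cong₂ _+_ (∑-*ˡ n c _) (∑-*ˡ n c _)) (sym (*-distribˡ-+ c (∑ n (F ∘ (true ∷_))) _))

  ∑-*ʳ : ∀ n c (F : List Bool → ℕ) → ∑ n (λ v → F v * c) ≡ ∑ n F * c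
  ∑-*ʳ n c F = trans (∑-cong n λ v _ → *-comm (F v) c) (trans (∑-*ˡ n c F) (*-comm c _))

  ∑-const : ∀ n c → ∑ n (λ _ → c) ≡ 2 ^ n * c
  ∑-const zero    c = sym (+-identityʳ c)
  ∑-const (suc n) c = trans (cong₂ _+_ (∑-const n c) (∑-const n c)) (lemma (2 ^ n) c)
    where
    lemma : ∀ p c → p * c + p * c ≡ 2 * p * c
    lemma = solve-∀

  ∑-++ : ∀ m n (F : List Bool → ℕ) → ∑ (m + n) F ≡ ∑ m (λ u → ∑ n (λ v → F (u ++ v)))
  ∑-++ zero    n F = refl
  ∑-++ (suc m) n F = cong₂ _+_ (∑-++ m n _) (∑-++ m n _)

  ∑-∷ʳ : ∀ n (F : List Bool → ℕ) → ∑ (suc n) F ≡ ∑ n (λ v → F (v ∷ʳ true)) + ∑ n (λ v → F (v ∷ʳ false))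
  ∑-∷ʳ zero    F = refl
  ∑-∷ʳ (suc n) F = trans (cong₂ _+_ (∑-∷ʳ n (F ∘ (true ∷_))) (∑-∷ʳ n (F ∘ (false ∷_))))
                         (+-interchange (∑ n (λ v → F (true ∷ v ∷ʳ true))) _ _ _)

  ∑-reverse : ∀ n (F : List Bool → ℕ) → ∑ n (F ∘ reverse) ≡ ∑ n F
  ∑-reverse zero    F = refl
  ∑-reverse (suc n) F = trans
    (cong₂ _+_ (lemma true) (lemma false))
    (sym (∑-∷ʳ n F))
    where
    lemma : ∀ b → ∑ n (λ v → F (reverse (b ∷ v))) ≡ ∑ n (λ v → F (v ∷ʳ b))
    lemma b = trans (∑-cong n λ v _ → cong F (unfold-reverse b v)) (∑-reverse n (λ v → F (v ∷ʳ b)))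

  ∑-swap : ∀ m n (F : List Bool → List Bool → ℕ) → ∑ m (λ u → ∑ n (F u)) ≡ ∑ n (λ v → ∑ m (λ u → F u v))
  ∑-swap zero    n F = refl
  ∑-swap (suc m) n F = trans (cong₂ _+_ (∑-swap m n _) (∑-swap m n _)) (sym (∑-+ n _ _))

∑-product : ∀ m n (F G : List Bool → ℕ) → ∑ m (λ u → ∑ n (λ v → F u * G v)) ≡ ∑ m F * ∑ n G
∑-product m n F G = trans (∑-cong m λ u _ → ∑-*ˡ n (F u) G) (∑-*ʳ m (∑ n G) F)

∑∑-mono : ∀ n {F G : List Bool → List Bool → ℕ} →
          (∀ u v → length u ≡ n → length v ≡ n → F u v ≤ G u v) → ∑∑ n F ≤ ∑∑ n G
∑∑-mono n F≤G = ∑-mono n λ u eu → ∑-mono n λ v ev → F≤G u v eu ev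

∑∑-cong : ∀ n {F G : List Bool → List Bool → ℕ} →
          (∀ u v → length u ≡ n → length v ≡ n → F u v ≡ G u v) → ∑∑ n F ≡ ∑∑ n G
∑∑-cong n F≡G = ∑-cong n λ u eu → ∑-cong n λ v ev → F≡G u v eu ev

∑∑-+ : ∀ n (F G : List Bool → List Bool → ℕ) → ∑∑ n (λ u v → F u v + G u v) ≡ ∑∑ n F + ∑∑ n G
∑∑-+ n F G = trans (∑-cong n λ u _ → ∑-+ n (F u) (G u)) (∑-+ n _ _)

∑∑-*ˡ : ∀ n c (F : List Bool → List Bool → ℕ) → ∑∑ n (λ u v → c * F u v) ≡ c * ∑∑ n F
∑∑-*ˡ n c F = trans (∑-cong n λ u _ → ∑-*ˡ n c (F u)) (∑-*ˡ n c _)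

^-distrib-* : ∀ a b n → (a * b) ^ n ≡ a ^ n * b ^ n
^-distrib-* a b zero    = refl
^-distrib-* a b (suc n) = trans (cong (a * b *_) (^-distrib-* a b n)) (lemma a b (a ^ n) (b ^ n))
  where
  lemma : ∀ a b p q → a * b * (p * q) ≡ a * p * (b * q)
  lemma = solve-∀

2^*2^ : ∀ n → 2 ^ n * 2 ^ n ≡ 4 ^ n
2^*2^ n = sym (^-distrib-* 2 2 n)

∑∑-const : ∀ n c → ∑∑ n (λ _ _ → c) ≡ 4 ^ n * c
∑∑-const n c = begin
  ∑ n (λ _ → ∑ n (λ _ → c)) ≡⟨ ∑-const n _ ⟩
  2 ^ n * ∑ n (λ _ → c)     ≡⟨ cong (2 ^ n *_) (∑-const n c) ⟩
  2 ^ n * (2 ^ n * c)       ≡⟨ *-assoc (2 ^ n) (2 ^ n) c ⟨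
  2 ^ n * 2 ^ n * c         ≡⟨ cong (_* c) (2^*2^ n) ⟩
  4 ^ n * c                 ∎
  where open ≡-Reasoning

∑∑-suc : ∀ n (F : List Bool → List Bool → ℕ) → ∑∑ (suc n) F ≡
  (∑∑ n (λ u v → F (true ∷ u) (true ∷ v)) + ∑∑ n (λ u v → F (true ∷ u) (false ∷ v))) +
  (∑∑ n (λ u v → F (false ∷ u) (true ∷ v)) + ∑∑ n (λ u v → F (false ∷ u) (false ∷ v)))
∑∑-suc n F = trans (∑-suc n _) (cong₂ _+_ (lemma true) (lemma false))
  where
  lemma : ∀ a → ∑ n (λ u → ∑ (suc n) (F (a ∷ u))) ≡
          ∑∑ n (λ u v → F (a ∷ u) (true ∷ v)) + ∑∑ n (λ u v → F (a ∷ u) (false ∷ v))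
  lemma a = trans (∑-cong n λ u _ → ∑-suc n (F (a ∷ u))) (∑-+ n _ _)

𝟙 : Bool → ℕ
𝟙 true  = 1
𝟙 false = 0

𝟙≤1 : ∀ b → 𝟙 b ≤ 1
𝟙≤1 true  = ≤-refl
𝟙≤1 false = z≤n

-- Sums of sets of naturals given by their characteristic words

at : List Bool → ℕ → Bool
at []      _       = false
at (a ∷ A) zero    = a
at (a ∷ A) (suc x) = at A x

conv : List Bool → List Bool → ℕ → Bool
conv []      B i       = false
conv (a ∷ A) B zero    = a ∧ at B zero
conv (a ∷ A) B (suc i) = (a ∧ at B (suc i)) ∨ conv A B i

≡-from-⇔ : ∀ {b c} → (b ≡ true → c ≡ true) → (c ≡ true → b ≡ true) → b ≡ c
≡-from-⇔ {true}  {c}     f g = sym (f refl)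
≡-from-⇔ {false} {false} f g = refl
≡-from-⇔ {false} {true}  f g = g refl

∨-true⁻ : ∀ b {c} → b ∨ c ≡ true → b ≡ true ⊎ c ≡ true
∨-true⁻ true  e = inj₁ refl
∨-true⁻ false e = inj₂ e

∧-true⁻ : ∀ b {c} → b ∧ c ≡ true → b ≡ true × c ≡ true
∧-true⁻ true e = refl , e

conv⁻ : ∀ A B i → conv A B i ≡ true → ∃[ x ] ∃[ y ] (x + y ≡ i × at A x ≡ true × at B y ≡ true)
conv⁻ (a ∷ A) B zero    e with ∧-true⁻ a e
... | ea , eb = 0 , 0 , refl , ea , eb
conv⁻ (a ∷ A) B (suc i) e with ∨-true⁻ (a ∧ at B (suc i)) e
... | inj₁ e₁ = let ea , eb = ∧-true⁻ a e₁ in 0 , suc i , refl , ea , eb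
... | inj₂ e₂ = let x , y , s , ea , eb = conv⁻ A B i e₂ in suc x , y , cong suc s , ea , eb

conv⁺ : ∀ A B x y → at A x ≡ true → at B y ≡ true → conv A B (x + y) ≡ true
conv⁺ (true ∷ A) B zero    zero    refl eb = eb
conv⁺ (true ∷ A) B zero    (suc y) refl eb rewrite eb = refl
conv⁺ (a ∷ A)    B (suc x) y       ea   eb rewrite conv⁺ A B x y ea eb = ∨-zeroʳ _

conv-comm : ∀ A B i → conv A B i ≡ conv B A i
conv-comm A B i = ≡-from-⇔ (to A B) (to B A)
  where
  to : ∀ A B → conv A B i ≡ true → conv B A i ≡ true
  to A B e = let x , y , s , ea , eb = conv⁻ A B i e in
    subst (λ k → conv B A k ≡ true) (trans (+-comm y x) s) (conv⁺ B A y x eb ea)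

conv-cong : ∀ A A′ B B′ i → (∀ x → x ≤ i → at A x ≡ at A′ x) → (∀ y → y ≤ i → at B y ≡ at B′ y) →
            conv A B i ≡ conv A′ B′ i
conv-cong A A′ B B′ i eA eB = ≡-from-⇔
  (to A A′ B B′ eA eB) (to A′ A B′ B (λ x l → sym (eA x l)) (λ x l → sym (eB x l)))
  where
  to : ∀ A A′ B B′ → (∀ x → x ≤ i → at A x ≡ at A′ x) → (∀ y → y ≤ i → at B y ≡ at B′ y) →
       conv A B i ≡ true → conv A′ B′ i ≡ true
  to A A′ B B′ eA eB e = let x , y , s , ea , eb = conv⁻ A B i e in
    subst (λ k → conv A′ B′ k ≡ true) s
      (conv⁺ A′ B′ x y (trans (sym (eA x (≤-trans (m≤m+n x y) (≤-reflexive s)))) ea)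
                       (trans (sym (eB y (≤-trans (m≤n+m y x) (≤-reflexive s)))) eb))

at-++ˡ : ∀ A A′ x → x < length A → at (A ++ A′) x ≡ at A x
at-++ˡ (a ∷ A) A′ zero    _         = refl
at-++ˡ (a ∷ A) A′ (suc x) (s≤s x<A) = at-++ˡ A A′ x x<A

at-++ʳ : ∀ A A′ x → at (A ++ A′) (length A + x) ≡ at A′ x
at-++ʳ []      A′ x = refl
at-++ʳ (a ∷ A) A′ x = at-++ʳ A A′ x

at⇒< : ∀ A x → at A x ≡ true → x < length A
at⇒< (a ∷ A) zero    e = s≤s z≤n
at⇒< (a ∷ A) (suc x) e = s≤s (at⇒< A x e)

conv-++ : ∀ A A′ B B′ i → i < length A → i < length B → conv (A ++ A′) (B ++ B′) i ≡ conv A B i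
conv-++ A A′ B B′ i i<A i<B = conv-cong (A ++ A′) A (B ++ B′) B i
  (λ x x≤i → at-++ˡ A A′ x (≤-<-trans x≤i i<A)) (λ y y≤i → at-++ˡ B B′ y (≤-<-trans y≤i i<B))

conv-∷ʳ : ∀ A a B j → conv (A ∷ʳ a) B (length A + j) ≡ conv A B (length A + j) ∨ (a ∧ at B j)
conv-∷ʳ []       a B zero    = refl
conv-∷ʳ []       a B (suc j) = ∨-identityʳ _
conv-∷ʳ (a′ ∷ A) a B j       = trans (cong ((a′ ∧ at B (suc (length A + j))) ∨_) (conv-∷ʳ A a B j))
                                     (sym (∨-assoc (a′ ∧ at B (suc (length A + j))) _ _))

conv-∷ʳ² : ∀ A B a b j → length A ≡ length B → conv (A ∷ʳ a) (B ∷ʳ b) (length A + j) ≡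
           (conv A B (length A + j) ∨ (b ∧ at A j)) ∨ (a ∧ at (B ∷ʳ b) j)
conv-∷ʳ² A B a b j e = trans (conv-∷ʳ A a (B ∷ʳ b) j) (cong (_∨ (a ∧ at (B ∷ʳ b) j)) (begin
  conv A (B ∷ʳ b) (length A + j)             ≡⟨ conv-comm A _ _ ⟩
  conv (B ∷ʳ b) A (length A + j)             ≡⟨ cong (λ l → conv (B ∷ʳ b) A (l + j)) e ⟩
  conv (B ∷ʳ b) A (length B + j)             ≡⟨ conv-∷ʳ B b A j ⟩
  conv B A (length B + j) ∨ (b ∧ at A j)     ≡⟨ cong (_∨ (b ∧ at A j)) (conv-comm B A _) ⟩
  conv A B (length B + j) ∨ (b ∧ at A j)     ≡⟨ cong (λ l → conv A B (l + j) ∨ (b ∧ at A j)) e ⟨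
  conv A B (length A + j) ∨ (b ∧ at A j)     ∎))
  where open ≡-Reasoning

misses : ℕ → ℕ → (ℕ → Bool) → ℕ
misses t zero    p = 0
misses t (suc r) p = 𝟙 (not (p t)) + misses (suc t) r p

misses-cong : ∀ t r {p q : ℕ → Bool} → (∀ i → t ≤ i → i < t + r → p i ≡ q i) → misses t r p ≡ misses t r q
misses-cong t zero    p≡q = refl
misses-cong t (suc r) p≡q = cong₂ _+_
  (cong (𝟙 ∘ not) (p≡q t ≤-refl (m<m+n t (s≤s z≤n))))
  (misses-cong (suc t) r λ i t<i i<t+r → p≡q i (<⇒≤ t<i) (subst (i <_) (sym (+-suc t r)) i<t+r))

misses-+ : ∀ t r s p → misses t (r + s) p ≡ misses t r p + misses (t + r) s p
misses-+ t zero    s p = cong (λ t → misses t s p) (sym (+-identityʳ t))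
misses-+ t (suc r) s p = trans
  (cong (𝟙 (not (p t)) +_) (trans (misses-+ (suc t) r s p)
     (cong (λ k → misses (suc t) r p + misses k s p) (sym (+-suc t r)))))
  (sym (+-assoc (𝟙 (not (p t))) _ _))

-- The number of values allowed for a bit that must not be 1 together with the given one.
options : Bool → ℕ
options true  = 1
options false = 2

optionsUpTo : List Bool → ℕ → ℕ
optionsUpTo A zero    = options (at A 0)
optionsUpTo A (suc j) = optionsUpTo A j * options (at A (suc j))

optionsUpTo-∷ : ∀ a A j → optionsUpTo (a ∷ A) (suc j) ≡ options a * optionsUpTo A j
optionsUpTo-∷ a A zero    = refl
optionsUpTo-∷ a A (suc j) = trans (cong (_* options (at A (suc j))) (optionsUpTo-∷ a A j)) (*-assoc (options a) _ _)

conv-zero : ∀ A B → conv A B 0 ≡ at A 0 ∧ at B 0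
conv-zero []      B = refl
conv-zero (a ∷ A) B = refl

conv-∷ : ∀ A b B i → conv A (b ∷ B) (suc i) ≡ (b ∧ at A (suc i)) ∨ conv A B i
conv-∷ A b B i = trans (conv-comm A (b ∷ B) (suc i)) (cong ((b ∧ at A (suc i)) ∨_) (conv-comm B A i))

opaque
  unfolding ∑

  -- The condition j ∉ A + B restricts each of the bits b_0, ..., b_j separately: b_(j - x) must be
  -- 0 if x ∈ A and is free otherwise. The remaining e bits are free.
  ∑-avoid : ∀ A j e → ∑ (suc j + e) (λ B → 𝟙 (not (conv A B j))) ≡ optionsUpTo A j * 2 ^ e
  ∑-avoid A zero e = trans (cong₂ _+_ (first true) (first false)) (lemma (at A 0) (2 ^ e))
    where
    first : ∀ b → ∑ e (λ B → 𝟙 (not (conv A (b ∷ B) 0))) ≡ 2 ^ e * 𝟙 (not (at A 0 ∧ b))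
    first b = trans (∑-cong e λ B _ → cong (𝟙 ∘ not) (conv-zero A (b ∷ B))) (∑-const e _)
    lemma : ∀ a p → p * 𝟙 (not (a ∧ true)) + p * 𝟙 (not (a ∧ false)) ≡ options a * p
    lemma true  = solve-∀
    lemma false = solve-∀
  ∑-avoid A (suc j) e = begin
    ∑ (suc j + e) (λ B → 𝟙 (not (conv A (true ∷ B) (suc j)))) + ∑ (suc j + e) (λ B → 𝟙 (not (conv A (false ∷ B) (suc j))))
      ≡⟨ cong₂ _+_ (∑-cong (suc j + e) λ B _ → cong (𝟙 ∘ not) (conv-∷ A true B j))
                   (trans (∑-cong (suc j + e) λ B _ → cong (𝟙 ∘ not) (conv-∷ A false B j)) (∑-avoid A j e)) ⟩
    ∑ (suc j + e) (λ B → 𝟙 (not (at A (suc j) ∨ conv A B j))) + optionsUpTo A j * 2 ^ e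
      ≡⟨ lemma (at A (suc j)) ⟩
    optionsUpTo A j * options (at A (suc j)) * 2 ^ e ∎
    where
    open ≡-Reasoning
    double : ∀ x y → x * y + x * y ≡ x * 2 * y
    double = solve-∀
    lemma : ∀ a → ∑ (suc j + e) (λ B → 𝟙 (not (a ∨ conv A B j))) + optionsUpTo A j * 2 ^ e ≡ optionsUpTo A j * options a * 2 ^ e
    lemma true  = cong₂ _+_ (trans (∑-const (suc j + e) 0) (*-zeroʳ (2 ^ (suc j + e)))) (cong (_* 2 ^ e) (sym (*-identityʳ (optionsUpTo A j))))
    lemma false = trans (cong (_+ optionsUpTo A j * 2 ^ e) (∑-avoid A j e)) (double (optionsUpTo A j) (2 ^ e))

  ∑-optionsUpTo : ∀ k → ∑ (suc k) (λ P → optionsUpTo P k) ≡ 3 ^ suc k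
  ∑-optionsUpTo zero    = refl
  ∑-optionsUpTo (suc k) = begin
    ∑ (suc k) (λ P → optionsUpTo (true ∷ P) (suc k)) + ∑ (suc k) (λ P → optionsUpTo (false ∷ P) (suc k))
      ≡⟨ cong₂ _+_ (part true) (part false) ⟩
    1 * 3 ^ suc k + 2 * 3 ^ suc k
      ≡⟨ *-distribʳ-+ (3 ^ suc k) 1 2 ⟨
    3 ^ suc (suc k) ∎
    where
    open ≡-Reasoning
    part : ∀ a → ∑ (suc k) (λ P → optionsUpTo (a ∷ P) (suc k)) ≡ options a * 3 ^ suc k
    part a = trans (∑-cong (suc k) λ P _ → optionsUpTo-∷ a P k) (trans (∑-*ˡ (suc k) (options a) (λ P → optionsUpTo P k)) (cong (options a *_) (∑-optionsUpTo k)))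

-- The k + 1 pairs of bits at positions x and k - x are disjoint, and each has three values other
-- than (1, 1).
∑∑-avoid : ∀ k → ∑∑ (suc k) (λ P Q → 𝟙 (not (conv P Q k))) ≡ 3 ^ suc k
∑∑-avoid k = trans (∑-cong (suc k) λ P _ → subst (λ l → ∑ l (λ Q → 𝟙 (not (conv P Q k))) ≡ optionsUpTo P k)
                      (+-identityʳ (suc k)) (trans (∑-avoid P k 0) (*-identityʳ (optionsUpTo P k)))) (∑-optionsUpTo k)

-- Probability that a single integer is missing, given prefixes

𝟙-not-mono : ∀ {p q} → (p ≡ true → q ≡ true) → 𝟙 (not q) ≤ 𝟙 (not p)
𝟙-not-mono {p}     {true}  f = z≤n
𝟙-not-mono {true}  {false} f = contradiction (f refl) λ ()
𝟙-not-mono {false} {false} f = ≤-refl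

-- Collects obstructions: every `p` that implies `q` fails when `q` fails, so `𝟙 (not q)` is at most
-- a product of such indicators. Once these depend on disjoint blocks of bits, the sum of the
-- product factors.
𝟙-not-* : ∀ {p x q} → (p ≡ true → q ≡ true) → 𝟙 (not q) ≤ x → 𝟙 (not q) ≤ 𝟙 (not p) * x
𝟙-not-* {p} {x} {true}  f l = z≤n
𝟙-not-* {true}  {x} {false} f l = contradiction (f refl) λ ()
𝟙-not-* {false} {x} {false} f l = ≤-trans l (≤-reflexive (sym (+-identityʳ x)))

at-++⁺ˡ : ∀ A A′ x → at A x ≡ true → at (A ++ A′) x ≡ true
at-++⁺ˡ A A′ x e = trans (at-++ˡ A A′ x (at⇒< A x e)) e

at-++⁺ʳ : ∀ A A′ {l} x → length A ≡ l → at A′ x ≡ true → at (A ++ A′) (l + x) ≡ true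
at-++⁺ʳ A A′ x refl e = trans (at-++ʳ A A′ x) e

conv-++⁺ : ∀ A A′ B B′ j → conv A B′ j ≡ true → conv (A ++ A′) (B ++ B′) (length B + j) ≡ true
conv-++⁺ A A′ B B′ j e = let x , y , s , ea , eb = conv⁻ A B′ j e in
  subst (λ i → conv (A ++ A′) (B ++ B′) i ≡ true)
    (trans (lemma x (length B) y) (cong (length B +_) s))
    (conv⁺ (A ++ A′) (B ++ B′) x (length B + y) (at-++⁺ˡ A A′ x ea) (at-++⁺ʳ B B′ y refl eb))
  where
  lemma : ∀ x b y → x + (b + y) ≡ b + (x + y)
  lemma = solve-∀

conv-++⁺′ : ∀ A A′ B B′ j → length A ≡ length B → conv B A′ j ≡ true → conv (A ++ A′) (B ++ B′) (length B + j) ≡ true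
conv-++⁺′ A A′ B B′ j l e = trans (conv-comm (A ++ A′) (B ++ B′) (length B + j))
  (trans (cong (λ k → conv (B ++ B′) (A ++ A′) (k + j)) (sym l)) (conv-++⁺ B B′ A A′ j e))

conv-++⁺″ : ∀ A A′ B B′ j → conv A′ B′ j ≡ true → conv (A ++ A′) (B ++ B′) (length A + (length B + j)) ≡ true
conv-++⁺″ A A′ B B′ j e = let x , y , s , ea , eb = conv⁻ A′ B′ j e in
  subst (λ i → conv (A ++ A′) (B ++ B′) i ≡ true)
    (trans (lemma (length A) x (length B) y) (cong (λ k → length A + (length B + k)) s))
    (conv⁺ (A ++ A′) (B ++ B′) (length A + x) (length B + y) (at-++⁺ʳ A A′ x refl ea) (at-++⁺ʳ B B′ y refl eb))
  where
  lemma : ∀ a x b y → (a + x) + (b + y) ≡ a + (b + (x + y))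
  lemma = solve-∀

-- Uses the pairs of one prefix bit and one new bit. B constrains only A′ and A constrains only B′,
-- hence the product.
missing-near : ∀ A B j e → length A ≡ length B →
  ∑∑ (suc j + e) (λ A′ B′ → 𝟙 (not (conv (A ++ A′) (B ++ B′) (length B + j)))) ≤ optionsUpTo A j * optionsUpTo B j * 4 ^ e
missing-near A B j e l = begin
  ∑∑ r (λ A′ B′ → 𝟙 (not (conv (A ++ A′) (B ++ B′) (length B + j))))
    ≤⟨ ∑∑-mono r (λ A′ B′ _ _ → 𝟙-not-* {conv B A′ j} (conv-++⁺′ A A′ B B′ j l)
                                        (𝟙-not-mono {conv A B′ j} (conv-++⁺ A A′ B B′ j))) ⟩
  ∑∑ r (λ A′ B′ → 𝟙 (not (conv B A′ j)) * 𝟙 (not (conv A B′ j)))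
    ≡⟨ ∑-product r r _ _ ⟩
  ∑ r (λ A′ → 𝟙 (not (conv B A′ j))) * ∑ r (λ B′ → 𝟙 (not (conv A B′ j)))
    ≡⟨ cong₂ _*_ (∑-avoid B j e) (∑-avoid A j e) ⟩
  (optionsUpTo B j * 2 ^ e) * (optionsUpTo A j * 2 ^ e)
    ≡⟨ lemma (optionsUpTo A j) (optionsUpTo B j) (2 ^ e) ⟩
  optionsUpTo A j * optionsUpTo B j * (2 ^ e * 2 ^ e)
    ≡⟨ cong (optionsUpTo A j * optionsUpTo B j *_) (2^*2^ e) ⟩
  optionsUpTo A j * optionsUpTo B j * 4 ^ e ∎
  where
  open ≤-Reasoning
  r = suc j + e
  lemma : ∀ a b p → (b * p) * (a * p) ≡ a * b * (p * p)
  lemma = solve-∀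

-- Write t = m + 1. The integer 2 t + k is the sum of k + 1 pairs of new bits, all among the first k
-- + 1 new positions on each side, and of pairs matching the t bits of either prefix with the t new
-- bits after those positions. The three families use disjoint bits, so their counts multiply.
missing-far : ∀ A B m k e → length A ≡ suc m → length B ≡ suc m →
  ∑∑ (suc k + (suc m + e)) (λ A′ B′ → 𝟙 (not (conv (A ++ A′) (B ++ B′) (suc m + (suc m + k)))))
  ≤ optionsUpTo A m * optionsUpTo B m * 3 ^ suc k * 4 ^ e
missing-far A B m k e lA lB = begin
  ∑∑ (suc k + r) X
    ≡⟨ ∑-++ (suc k) r _ ⟩
  ∑ (suc k) (λ P → ∑ r (λ A″ → ∑ (suc k + r) (X (P ++ A″))))
    ≡⟨ (∑-cong (suc k) λ P _ → ∑-cong r λ A″ _ → ∑-++ (suc k) r _) ⟩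
  ∑ (suc k) (λ P → ∑ r (λ A″ → ∑ (suc k) (λ Q → ∑ r (λ B″ → X (P ++ A″) (Q ++ B″)))))
    ≤⟨ (∑-mono (suc k) λ P lP → ∑-mono r λ A″ _ → ∑-mono (suc k) λ Q lQ → ∑-mono r λ B″ _ → pointwise P A″ Q B″ lP lQ) ⟩
  ∑ (suc k) (λ P → ∑ r (λ A″ → ∑ (suc k) (λ Q → ∑ r (λ B″ → (f P Q * h A″) * g B″))))
    ≡⟨ (∑-cong (suc k) λ P _ → ∑-cong r λ A″ _ → trans (∑-product (suc k) r _ g) (cong (_* ∑ r g) (∑-*ʳ (suc k) (h A″) (f P)))) ⟩
  ∑ (suc k) (λ P → ∑ r (λ A″ → (∑ (suc k) (f P) * h A″) * ∑ r g))
    ≡⟨ (∑-cong (suc k) λ P _ → ∑-*ʳ r (∑ r g) _) ⟩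
  ∑ (suc k) (λ P → ∑ r (λ A″ → ∑ (suc k) (f P) * h A″) * ∑ r g)
    ≡⟨ ∑-*ʳ (suc k) (∑ r g) _ ⟩
  ∑ (suc k) (λ P → ∑ r (λ A″ → ∑ (suc k) (f P) * h A″)) * ∑ r g
    ≡⟨ cong (_* ∑ r g) (∑-product (suc k) r (λ P → ∑ (suc k) (f P)) h) ⟩
  ∑∑ (suc k) f * ∑ r h * ∑ r g
    ≡⟨ cong₂ _*_ (cong₂ _*_ (∑∑-avoid k) (∑-avoid B m e)) (∑-avoid A m e) ⟩
  3 ^ suc k * (optionsUpTo B m * 2 ^ e) * (optionsUpTo A m * 2 ^ e)
    ≡⟨ lemma (3 ^ suc k) (optionsUpTo B m) (optionsUpTo A m) (2 ^ e) ⟩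
  optionsUpTo A m * optionsUpTo B m * 3 ^ suc k * (2 ^ e * 2 ^ e)
    ≡⟨ cong (optionsUpTo A m * optionsUpTo B m * 3 ^ suc k *_) (2^*2^ e) ⟩
  optionsUpTo A m * optionsUpTo B m * 3 ^ suc k * 4 ^ e ∎
  where
  open ≤-Reasoning
  r = suc m + e
  X : List Bool → List Bool → ℕ
  X A′ B′ = 𝟙 (not (conv (A ++ A′) (B ++ B′) (suc m + (suc m + k))))
  f : List Bool → List Bool → ℕ
  f P Q = 𝟙 (not (conv P Q k))
  g h : List Bool → ℕ
  g B″ = 𝟙 (not (conv A B″ m))
  h A″ = 𝟙 (not (conv B A″ m))
  lemma : ∀ t b a p → t * (b * p) * (a * p) ≡ a * b * t * (p * p)
  lemma = solve-∀
  index : ∀ m k → suc m + (suc k + m) ≡ suc m + (suc m + k)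
  index = solve-∀
  tail⁺ : ∀ Q B″ j → length Q ≡ suc k → ∀ A → conv A B″ j ≡ true → conv A (Q ++ B″) (suc k + j) ≡ true
  tail⁺ Q B″ j lQ A e = subst₂ (λ A l → conv A (Q ++ B″) (l + j) ≡ true) (++-identityʳ A) lQ
    (conv-++⁺ A [] Q B″ j e)
  pointwise : ∀ P A″ Q B″ → length P ≡ suc k → length Q ≡ suc k → X (P ++ A″) (Q ++ B″) ≤ (f P Q * h A″) * g B″
  pointwise P A″ Q B″ lP lQ = ≤-trans
    (𝟙-not-* {conv P Q k} middle (𝟙-not-* {conv B A″ m} left (𝟙-not-mono {conv A B″ m} right)))
    (≤-reflexive (sym (*-assoc (f P Q) (h A″) (g B″))))
    where
    middle : conv P Q k ≡ true → conv (A ++ (P ++ A″)) (B ++ (Q ++ B″)) (suc m + (suc m + k)) ≡ true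
    middle e = subst₂ (λ a b → conv (A ++ (P ++ A″)) (B ++ (Q ++ B″)) (a + (b + k)) ≡ true) lA lB
      (conv-++⁺″ A (P ++ A″) B (Q ++ B″) k
        (let x , y , s , ea , eb = conv⁻ P Q k e in
         subst (λ i → conv (P ++ A″) (Q ++ B″) i ≡ true) s
           (conv⁺ (P ++ A″) (Q ++ B″) x y (at-++⁺ˡ P A″ x ea) (at-++⁺ˡ Q B″ y eb))))
    left : conv B A″ m ≡ true → conv (A ++ (P ++ A″)) (B ++ (Q ++ B″)) (suc m + (suc m + k)) ≡ true
    left e = subst (λ i → conv (A ++ (P ++ A″)) (B ++ (Q ++ B″)) i ≡ true)
      (trans (cong (_+ (suc k + m)) lB) (index m k))
      (conv-++⁺′ A (P ++ A″) B (Q ++ B″) (suc k + m) (trans lA (sym lB)) (tail⁺ P A″ m lP B e))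
    right : conv A B″ m ≡ true → conv (A ++ (P ++ A″)) (B ++ (Q ++ B″)) (suc m + (suc m + k)) ≡ true
    right e = subst (λ i → conv (A ++ (P ++ A″)) (B ++ (Q ++ B″)) i ≡ true)
      (trans (cong (_+ (suc k + m)) lB) (index m k))
      (conv-++⁺ A (P ++ A″) B (Q ++ B″) (suc k + m) (tail⁺ Q B″ m lQ A e))

-- The branching procedure

tl : List Bool → List Bool
tl []      = []
tl (_ ∷ A) = A

at-tl : ∀ A j → at (tl A) j ≡ at A (suc j)
at-tl []      j = refl
at-tl (a ∷ A) j = refl

union : List Bool → List Bool → List Bool
union []      B       = B
union (a ∷ A) []      = a ∷ A
union (a ∷ A) (b ∷ B) = (a ∨ b) ∷ union A B

at-union : ∀ A B j → at (union A B) j ≡ at A j ∨ at B j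
at-union []      B       j       = refl
at-union (a ∷ A) []      zero    = sym (∨-identityʳ a)
at-union (a ∷ A) []      (suc j) = sym (∨-identityʳ (at A j))
at-union (a ∷ A) (b ∷ B) zero    = refl
at-union (a ∷ A) (b ∷ B) (suc j) = at-union A B j

mask : Bool → List Bool → List Bool
mask true  A = A
mask false A = []

at-mask : ∀ b A j → at (mask b A) j ≡ b ∧ at A j
at-mask true  A j = refl
at-mask false A j = refl

-- A finite or cofinite set of naturals, given by its characteristic word.
data Target : Set where
  all-or-none : Bool → Target
  _▹_         : Bool → Target → Target

infixr 5 _▹_

accepts : Target → ℕ → Bool
accepts (all-or-none b) m       = b
accepts (b ▹ T)         zero    = b
accepts (b ▹ T)         (suc m) = accepts T m

-- A missing integer replaces T by {m : m + 1 ∈ T}. The target itself thus keeps the count, and a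
-- branch is finished as soon as it becomes `all-or-none`.
advance : Bool → Target → Target
advance c     (all-or-none b) = all-or-none b
advance true  (b ▹ T)         = b ▹ T
advance false (b ▹ T)         = T

accepts-advance : ∀ c T m → accepts T (𝟙 (not c) + m) ≡ accepts (advance c T) m
accepts-advance c     (all-or-none b) m = refl
accepts-advance true  (b ▹ T)         m = refl
accepts-advance false (b ▹ T)         m = refl

-- For prefixes A and B of length t of two infinite random sets and the characteristic word C of
-- {j : t + j ∈ A + B}, the union bound for the probability that some i ≥ t is not in the sum
-- of the two sets is e / 4 ^ t, where (4 ^ t , e) is the value of the following function.
unionBound : List Bool → List Bool → List Bool → ℕ × ℕ
unionBound []      B       C = 1 , 3
unionBound (a ∷ A) []      C = 1 , 3
unionBound (a ∷ A) (b ∷ B) C = extend (at C 0) (unionBound A B (tl C))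
  where
  extend : Bool → ℕ × ℕ → ℕ × ℕ
  extend c (p , e) = 4 * p , options a * (options b * (if c then e else p + e))

-- New sums use a bit at position t: `b` with an element of A, or `a` with an element of `B ∷ʳ b`,
-- which includes the pair of the two new bits. This is the case j = 0 of such sums t + j, and
-- `future` treats j ≥ 1.
covered : List Bool → List Bool → List Bool → Bool → Bool → Bool
covered A B C a b = (at C 0 ∨ (b ∧ at A 0)) ∨ (a ∧ at (B ∷ʳ b) 0)

future : List Bool → List Bool → List Bool → Bool → Bool → List Bool
future A B C a b = union (union (tl C) (mask b (tl A))) (mask a (tl (B ∷ʳ b)))

-- A target that accepts 0 gets the trivial probability bound 1. A target that rejects 0 asks for at
-- least one further missing integer, so the smaller of 1 and the union bound applies.
leaf : ℕ → Bool → ℕ × ℕ → ℕ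
leaf f true  (p , e) = 16 ^ f * p
leaf f false (p , e) = 16 ^ f * (if p <ᵇ e then p else e)

-- bound f T A B C / (16 ^ f · 4 ^ length A) bounds the probability that the number of missing
-- integers ≥ length A lies in T. The cut-off K only decides where the branching stops, so the
-- bound is sound for every K.
module Tree (K : ℕ) where

  bound  : ℕ → Target → List Bool → List Bool → List Bool → ℕ
  node   : ℕ → Bool → Target → List Bool → List Bool → List Bool → ℕ × ℕ → ℕ
  branch : ℕ → Target → List Bool → List Bool → List Bool → Bool → Bool → ℕ

  bound f       (all-or-none true)  A B C = 16 ^ f * 4 ^ length A
  bound f       (all-or-none false) A B C = 0
  bound zero    (x ▹ T)             A B C = leaf 0 x (unionBound A B C)
  bound (suc f) (x ▹ T)             A B C = node f x T A B C (unionBound A B C)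

  -- Here p = 4 ^ t, so the test says (e / p) · 4 ^ -t < 1 / K: the union bound, weighted by the
  -- probability of reaching this node (up to a constant factor), is below 1 / K.
  node f x T A B C (p , e) = if e * K <ᵇ p * p then leaf (suc f) x (p , e) else
    ((branch f (x ▹ T) A B C true true  + branch f (x ▹ T) A B C true false) +
     (branch f (x ▹ T) A B C false true + branch f (x ▹ T) A B C false false))

  branch f T A B C a b = bound f (advance (covered A B C a b) T) (A ∷ʳ a) (B ∷ʳ b) (future A B C a b)

-- Soundness of the union bound

opaque
  sum< : ℕ → (ℕ → ℕ) → ℕ
  sum< zero    f = 0
  sum< (suc n) f = f 0 + sum< n (f ∘ suc)

opaque
  unfolding sum<

  sum<-zero : ∀ f → sum< 0 f ≡ 0
  sum<-zero f = refl

  sum<-suc : ∀ n f → sum< (suc n) f ≡ f 0 + sum< n (f ∘ suc)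
  sum<-suc n f = refl

  sum<-const : ∀ n c → sum< n (λ _ → c) ≡ n * c
  sum<-const zero    c = refl
  sum<-const (suc n) c = cong (c +_) (sum<-const n c)

  entry≤sum< : ∀ j {n} (f : ℕ → ℕ) → j < n → f j ≤ sum< n f
  entry≤sum< zero    f (s≤s _)   = m≤m+n (f 0) _
  entry≤sum< (suc j) f (s≤s j<n) = ≤-trans (entry≤sum< j (f ∘ suc) j<n) (m≤n+m _ (f 0))

  sum<-mono : ∀ n {f g : ℕ → ℕ} → (∀ j → j < n → f j ≤ g j) → sum< n f ≤ sum< n g
  sum<-mono zero    f≤g = z≤n
  sum<-mono (suc n) f≤g = +-mono-≤ (f≤g 0 z<s) (sum<-mono n λ j j<n → f≤g (suc j) (s<s j<n))

  sum<-cong : ∀ n {f g : ℕ → ℕ} → (∀ j → j < n → f j ≡ g j) → sum< n f ≡ sum< n g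
  sum<-cong zero    f≡g = refl
  sum<-cong (suc n) f≡g = cong₂ _+_ (f≡g 0 z<s) (sum<-cong n λ j j<n → f≡g (suc j) (s<s j<n))

  sum<-*ˡ : ∀ n c f → sum< n (λ j → c * f j) ≡ c * sum< n f
  sum<-*ˡ zero    c f = sym (*-zeroʳ c)
  sum<-*ˡ (suc n) c f = trans (cong (c * f 0 +_) (sum<-*ˡ n c (f ∘ suc))) (sym (*-distribˡ-+ c (f 0) _))

  misses-sum< : ∀ t r p → misses t r p ≡ sum< r (λ j → 𝟙 (not (p (t + j))))
  misses-sum< t zero    p = refl
  misses-sum< t (suc r) p = cong₂ _+_ (cong (𝟙 ∘ not ∘ p) (sym (+-identityʳ t)))
    (trans (misses-sum< (suc t) r p) (sum<-cong r λ j _ → cong (𝟙 ∘ not ∘ p) (sym (+-suc t j))))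

  ∑-sum< : ∀ n r (f : ℕ → List Bool → ℕ) → ∑ n (λ v → sum< r (λ j → f j v)) ≡ sum< r (λ j → ∑ n (f j))
  ∑-sum< n zero    f = trans (∑-const n 0) (*-zeroʳ (2 ^ n))
  ∑-sum< n (suc r) f = trans (∑-+ n _ _) (cong (∑ n (f 0) +_) (∑-sum< n r (f ∘ suc)))

∑∑-sum< : ∀ n r (f : ℕ → List Bool → List Bool → ℕ) →
          ∑∑ n (λ u v → sum< r (λ j → f j u v)) ≡ sum< r (λ j → ∑∑ n (f j))
∑∑-sum< n r f = trans (∑-cong n λ u _ → ∑-sum< n r (λ j → f j u)) (∑-sum< n r (λ j u → ∑ n (f j u)))

-- Given prefixes A and B of length t, the integer t + j is missing with probability at most
-- weight A B C j / 4 ^ suc j.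
weight : List Bool → List Bool → List Bool → ℕ → ℕ
weight []      B       C j       = 3 ^ suc j
weight (a ∷ A) []      C j       = 3 ^ suc j
weight (a ∷ A) (b ∷ B) C zero    = options a * options b * 𝟙 (not (at C 0))
weight (a ∷ A) (b ∷ B) C (suc j) = options a * options b * weight A B (tl C) j

weight-near : ∀ A B C j → j < length A → length A ≡ length B →
              weight A B C j ≡ optionsUpTo A j * optionsUpTo B j * 𝟙 (not (at C j))
weight-near (a ∷ A) (b ∷ B) C zero    _         _ = refl
weight-near (a ∷ A) (b ∷ B) C (suc j) (s≤s j<A) l = begin
  options a * options b * weight A B (tl C) j                           ≡⟨ cong (options a * options b *_) (weight-near A B (tl C) j j<A (suc-injective l)) ⟩
  options a * options b * (optionsUpTo A j * optionsUpTo B j * 𝟙 (not (at (tl C) j)))       ≡⟨ lemma (options a) (options b) (optionsUpTo A j) (optionsUpTo B j) _ ⟩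
  (options a * optionsUpTo A j) * (options b * optionsUpTo B j) * 𝟙 (not (at (tl C) j))     ≡⟨ cong₂ _*_ (cong₂ _*_ (optionsUpTo-∷ a A j) (optionsUpTo-∷ b B j)) (cong (𝟙 ∘ not) (sym (at-tl C j))) ⟨
  optionsUpTo (a ∷ A) (suc j) * optionsUpTo (b ∷ B) (suc j) * 𝟙 (not (at C (suc j))) ∎
  where
  open ≡-Reasoning
  lemma : ∀ a b p q r → a * b * (p * q * r) ≡ (a * p) * (b * q) * r
  lemma = solve-∀

weight-far : ∀ A B C m k → length A ≡ suc m → length B ≡ suc m →
             weight A B C (suc m + k) ≡ optionsUpTo A m * optionsUpTo B m * 3 ^ suc k
weight-far (a ∷ [])     (b ∷ [])     C zero    k lA lB = refl
weight-far (a ∷ a′ ∷ A) (b ∷ b′ ∷ B) C (suc m) k lA lB = begin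
  options a * options b * weight (a′ ∷ A) (b′ ∷ B) (tl C) (suc m + k)
    ≡⟨ cong (options a * options b *_) (weight-far (a′ ∷ A) (b′ ∷ B) (tl C) m k (suc-injective lA) (suc-injective lB)) ⟩
  options a * options b * (optionsUpTo (a′ ∷ A) m * optionsUpTo (b′ ∷ B) m * 3 ^ suc k)
    ≡⟨ lemma (options a) (options b) (optionsUpTo (a′ ∷ A) m) (optionsUpTo (b′ ∷ B) m) (3 ^ suc k) ⟩
  (options a * optionsUpTo (a′ ∷ A) m) * (options b * optionsUpTo (b′ ∷ B) m) * 3 ^ suc k
    ≡⟨ cong₂ (λ p q → p * q * 3 ^ suc k) (optionsUpTo-∷ a (a′ ∷ A) m) (optionsUpTo-∷ b (b′ ∷ B) m) ⟨
  optionsUpTo (a ∷ a′ ∷ A) (suc m) * optionsUpTo (b ∷ b′ ∷ B) (suc m) * 3 ^ suc k ∎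
  where
  open ≡-Reasoning
  lemma : ∀ a b p q r → a * b * (p * q * r) ≡ (a * p) * (b * q) * r
  lemma = solve-∀

Follows : List Bool → List Bool → List Bool → Set
Follows C A B = ∀ j → at C j ≡ conv A B (length A + j)

-- If t + j is a sum of prefix elements, it is never missing. Otherwise, for j < t every pair with
-- sum t + j has a bit in a prefix, while for j ≥ t pairs of two new bits appear as well; this
-- separates `missing-near` from `missing-far`.
missing-≤-weight : ∀ A B C r j → 0 < length A → length A ≡ length B → Follows C A B → j < r →
  4 ^ suc j * ∑∑ r (λ A′ B′ → 𝟙 (not (conv (A ++ A′) (B ++ B′) (length A + j)))) ≤ 4 ^ r * weight A B C j
missing-≤-weight A B C r j 0<A l F j<r with j <? length A
... | yes j<A = near (at C j) refl
  where
  e = r ∸ suc j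
  r≡ : suc j + e ≡ r
  r≡ = m+[n∸m]≡n j<r
  X : List Bool → List Bool → ℕ
  X A′ B′ = 𝟙 (not (conv (A ++ A′) (B ++ B′) (length A + j)))
  hits : at C j ≡ true → ∀ A′ B′ → conv (A ++ A′) (B ++ B′) (length A + j) ≡ true
  hits c A′ B′ = let x , y , s , ea , eb = conv⁻ A B (length A + j) (trans (sym (F j)) c) in
    subst (λ i → conv (A ++ A′) (B ++ B′) i ≡ true) s
      (conv⁺ (A ++ A′) (B ++ B′) x y (at-++⁺ˡ A A′ x ea) (at-++⁺ˡ B B′ y eb))
  regroup : ∀ j e x → j * (x * e) ≡ j * e * (x * 1)
  regroup = solve-∀
  near : ∀ c → at C j ≡ c → 4 ^ suc j * ∑∑ r X ≤ 4 ^ r * weight A B C j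
  near true  c = begin
    4 ^ suc j * ∑∑ r X             ≡⟨ cong (4 ^ suc j *_) (∑∑-cong r λ A′ B′ _ _ → cong (𝟙 ∘ not) (hits c A′ B′)) ⟩
    4 ^ suc j * ∑∑ r (λ _ _ → 0)   ≡⟨ cong (4 ^ suc j *_) (trans (∑∑-const r 0) (*-zeroʳ (4 ^ r))) ⟩
    4 ^ suc j * 0                  ≡⟨ *-zeroʳ (4 ^ suc j) ⟩
    0                              ≤⟨ z≤n ⟩
    4 ^ r * weight A B C j         ∎
    where open ≤-Reasoning
  near false c = begin
    4 ^ suc j * ∑∑ r X
      ≡⟨ cong₂ (λ r l → 4 ^ suc j * ∑∑ r (λ A′ B′ → 𝟙 (not (conv (A ++ A′) (B ++ B′) (l + j))))) (sym r≡) l ⟩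
    4 ^ suc j * ∑∑ (suc j + e) (λ A′ B′ → 𝟙 (not (conv (A ++ A′) (B ++ B′) (length B + j))))
      ≤⟨ *-monoʳ-≤ (4 ^ suc j) (missing-near A B j e l) ⟩
    4 ^ suc j * (optionsUpTo A j * optionsUpTo B j * 4 ^ e)
      ≡⟨ regroup (4 ^ suc j) (4 ^ e) (optionsUpTo A j * optionsUpTo B j) ⟩
    4 ^ suc j * 4 ^ e * (optionsUpTo A j * optionsUpTo B j * 1)
      ≡⟨ cong₂ _*_ (trans (sym (^-distribˡ-+-* 4 (suc j) e)) (cong (4 ^_) r≡))
                   (cong (λ b → optionsUpTo A j * optionsUpTo B j * 𝟙 (not b)) (sym c)) ⟩
    4 ^ r * (optionsUpTo A j * optionsUpTo B j * 𝟙 (not (at C j)))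
      ≡⟨ cong (4 ^ r *_) (weight-near A B C j j<A l) ⟨
    4 ^ r * weight A B C j ∎
    where open ≤-Reasoning
... | no j≮A = far (length A) refl 0<A
  where
  regroup : ∀ a b c x → a * b * (x * c) ≡ a * b * c * x
  regroup = solve-∀
  exponent : ∀ m k e → suc (suc m + k) + e ≡ suc k + (suc m + e)
  exponent = solve-∀
  far : ∀ t → length A ≡ t → 0 < t →
    4 ^ suc j * ∑∑ r (λ A′ B′ → 𝟙 (not (conv (A ++ A′) (B ++ B′) (length A + j)))) ≤ 4 ^ r * weight A B C j
  far (suc m) lA _ = begin
    4 ^ suc j * ∑∑ r (λ A′ B′ → 𝟙 (not (conv (A ++ A′) (B ++ B′) (length A + j))))
      ≡⟨ cong₂ (λ r i → 4 ^ suc j * ∑∑ r (λ A′ B′ → 𝟙 (not (conv (A ++ A′) (B ++ B′) i))))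
           r≡ (cong₂ _+_ lA (sym j≡)) ⟩
    4 ^ suc j * ∑∑ (suc k + (suc m + e)) (λ A′ B′ → 𝟙 (not (conv (A ++ A′) (B ++ B′) (suc m + (suc m + k)))))
      ≤⟨ *-monoʳ-≤ (4 ^ suc j) (missing-far A B m k e lA (trans (sym l) lA)) ⟩
    4 ^ suc j * (optionsUpTo A m * optionsUpTo B m * 3 ^ suc k * 4 ^ e)
      ≡⟨ lemma (4 ^ suc j) _ (4 ^ e) ⟩
    4 ^ suc j * 4 ^ e * (optionsUpTo A m * optionsUpTo B m * 3 ^ suc k)
      ≡⟨ cong₂ _*_ (trans (sym (^-distribˡ-+-* 4 (suc j) e)) (cong (4 ^_) (m+[n∸m]≡n j<r)))
                   (sym (weight-far A B C m k lA (trans (sym l) lA))) ⟩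
    4 ^ r * weight A B C (suc m + k)
      ≡⟨ cong (λ i → 4 ^ r * weight A B C i) j≡ ⟩
    4 ^ r * weight A B C j ∎
    where
    open ≤-Reasoning
    k = j ∸ suc m
    e = r ∸ suc j
    j≡ : suc m + k ≡ j
    j≡ = m+[n∸m]≡n (subst (_≤ j) lA (≮⇒≥ j≮A))
    r≡ : r ≡ suc k + (suc m + e)
    r≡ = trans (sym (m+[n∸m]≡n j<r)) (trans (cong (λ i → suc i + e) (sym j≡)) (exponent m k e))
    lemma : ∀ a x c → a * (x * c) ≡ a * c * x
    lemma = solve-∀

unionBound₁ : ∀ A B C → length A ≡ length B → proj₁ (unionBound A B C) ≡ 4 ^ length A
unionBound₁ []      B       C l = refl
unionBound₁ (a ∷ A) (b ∷ B) C l = cong (4 *_) (unionBound₁ A B (tl C) (suc-injective l))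

-- The series of (3/4) ^ (j + 1) has sum 3, which is the base value `1 , 3` of `unionBound`.
-- Dropping the first term turns π into 3 π and f j into 4 f (j + 1).
geometric : ∀ π s (f : ℕ → ℕ) → (∀ j → j < s → 4 ^ suc j * f j ≤ π * 3 ^ suc j) → sum< s f ≤ π * 3
geometric π zero    f bnd = ≤-trans (≤-reflexive (sum<-zero f)) z≤n
geometric π (suc s) f bnd = *-cancelˡ-≤ 4 (begin
  4 * sum< (suc s) f                       ≡⟨ cong (4 *_) (sum<-suc s f) ⟩
  4 * (f 0 + sum< s (f ∘ suc))             ≡⟨ *-distribˡ-+ 4 (f 0) _ ⟩
  4 * f 0 + 4 * sum< s (f ∘ suc)           ≤⟨ +-mono-≤ (bnd 0 z<s) tail-bound ⟩
  π * 3 + π * 3 * 3                        ≡⟨ lemma π ⟩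
  4 * (π * 3)                              ∎)
  where
  open ≤-Reasoning
  lemma : ∀ π → π * 3 + π * 3 * 3 ≡ 4 * (π * 3)
  lemma = solve-∀
  regroup : ∀ p x → p * (4 * x) ≡ 4 * p * x
  regroup = solve-∀
  tail-bound : 4 * sum< s (f ∘ suc) ≤ π * 3 * 3
  tail-bound = ≤-trans (≤-reflexive (sym (sum<-*ˡ s 4 (f ∘ suc))))
    (geometric (π * 3) s (λ j → 4 * f (suc j)) λ j j<s → ≤-trans
      (≤-reflexive (regroup (4 ^ suc j) (f (suc j))))
      (≤-trans (bnd (suc j) (s<s j<s)) (≤-reflexive (sym (*-assoc π 3 (3 ^ suc j))))))

-- `weight` and `unionBound` recurse on the prefixes in the same way. Peeling off the leading bits
-- moves their option counts into π and a factor 4 into f, so the induction needs both to be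
-- arbitrary.
sum<-≤-unionBound : ∀ A B C → length A ≡ length B → ∀ π s (f : ℕ → ℕ) →
  (∀ j → j < s → 4 ^ suc j * f j ≤ π * weight A B C j) →
  4 ^ length A * sum< s f ≤ π * proj₂ (unionBound A B C)
sum<-≤-unionBound []      B       C l π s f bnd = ≤-trans (≤-reflexive (+-identityʳ _)) (geometric π s f bnd)
sum<-≤-unionBound (a ∷ A) (b ∷ B) C l π zero f bnd = ≤-trans
  (≤-reflexive (trans (cong (4 ^ suc (length A) *_) (sum<-zero f)) (*-zeroʳ (4 ^ suc (length A))))) z≤n
sum<-≤-unionBound (a ∷ A) (b ∷ B) C l π (suc s) f bnd = begin
  4 * p * sum< (suc s) f
    ≡⟨ cong (4 * p *_) (sum<-suc s f) ⟩
  4 * p * (f 0 + sum< s (f ∘ suc))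
    ≡⟨ distribute p (f 0) _ ⟩
  p * (4 * f 0) + p * (4 * sum< s (f ∘ suc))
    ≡⟨ cong (λ x → p * (4 * f 0) + p * x) (sum<-*ˡ s 4 (f ∘ suc)) ⟨
  p * (4 * f 0) + p * sum< s (λ j → 4 * f (suc j))
    ≤⟨ +-mono-≤ (*-monoʳ-≤ p (bnd 0 z<s))
         (sum<-≤-unionBound A B (tl C) (suc-injective l) (π * (options a * options b)) s (λ j → 4 * f (suc j)) λ j j<s → ≤-trans
            (≤-reflexive (regroup (4 ^ suc j) (f (suc j))))
            (≤-trans (bnd (suc j) (s<s j<s)) (≤-reflexive (sym (*-assoc π (options a * options b) _))))) ⟩
  p * (π * (options a * options b * 𝟙 (not (at C 0)))) + π * (options a * options b) * e
    ≡⟨ collect p π (options a) (options b) (𝟙 (not (at C 0))) e ⟩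
  π * (options a * (options b * (𝟙 (not (at C 0)) * p + e)))
    ≡⟨ cong (λ x → π * (options a * (options b * x))) (sym (last-step (at C 0))) ⟩
  π * proj₂ (unionBound (a ∷ A) (b ∷ B) C) ∎
  where
  open ≤-Reasoning
  p = 4 ^ length A
  e = proj₂ (unionBound A B (tl C))
  distribute : ∀ p x y → 4 * p * (x + y) ≡ p * (4 * x) + p * (4 * y)
  distribute = solve-∀
  regroup : ∀ p x → p * (4 * x) ≡ 4 * p * x
  regroup = solve-∀
  collect : ∀ p π a b c e → p * (π * (a * b * c)) + π * (a * b) * e ≡ π * (a * (b * (c * p + e)))
  collect = solve-∀
  last-step : ∀ c → (if c then e else proj₁ (unionBound A B (tl C)) + e) ≡ 𝟙 (not c) * p + e
  last-step true  = refl
  last-step false = cong (_+ e) (trans (unionBound₁ A B (tl C) (suc-injective l)) (sym (+-identityʳ p)))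

-- Soundness of the branching procedure

tally : Target → List Bool → List Bool → ℕ → ℕ
tally T A B r = ∑∑ r (λ A′ B′ → 𝟙 (accepts T (misses (length A) r (conv (A ++ A′) (B ++ B′)))))

tally≤4^ : ∀ T A B r → tally T A B r ≤ 4 ^ r
tally≤4^ T A B r = begin
  tally T A B r         ≤⟨ ∑∑-mono r (λ _ _ _ _ → 𝟙≤1 _) ⟩
  ∑∑ r (λ _ _ → 1)      ≡⟨ ∑∑-const r 1 ⟩
  4 ^ r * 1             ≡⟨ *-identityʳ _ ⟩
  4 ^ r                 ∎
  where open ≤-Reasoning

𝟙-accepts≤ : ∀ T m → 𝟙 (accepts (false ▹ T) m) ≤ m
𝟙-accepts≤ T zero    = z≤n
𝟙-accepts≤ T (suc m) = ≤-trans (𝟙≤1 _) (s≤s z≤n)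

-- A target that rejects 0 accepts m only if m ≥ 1, so its indicator is at most the number of
-- missing integers, whose expectation is the sum of the individual probabilities.
tally≤unionBound : ∀ T A B C r → 0 < length A → length A ≡ length B → Follows C A B →
                   4 ^ length A * tally (false ▹ T) A B r ≤ 4 ^ r * proj₂ (unionBound A B C)
tally≤unionBound T A B C r 0<A l F = begin
  4 ^ length A * tally (false ▹ T) A B r
    ≤⟨ *-monoʳ-≤ (4 ^ length A) (∑∑-mono r λ _ _ _ _ → 𝟙-accepts≤ T _) ⟩
  4 ^ length A * ∑∑ r (λ A′ B′ → misses (length A) r (conv (A ++ A′) (B ++ B′)))
    ≡⟨ cong (4 ^ length A *_) (trans (∑∑-cong r λ A′ B′ _ _ → misses-sum< (length A) r (conv (A ++ A′) (B ++ B′))) (∑∑-sum< r r _)) ⟩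
  4 ^ length A * sum< r (λ j → ∑∑ r (λ A′ B′ → 𝟙 (not (conv (A ++ A′) (B ++ B′) (length A + j)))))
    ≤⟨ sum<-≤-unionBound A B C l (4 ^ r) r _ (λ j → missing-≤-weight A B C r j 0<A l F) ⟩
  4 ^ r * proj₂ (unionBound A B C) ∎
  where open ≤-Reasoning

length-∷ʳ : ∀ (A : List Bool) a → length (A ∷ʳ a) ≡ suc (length A)
length-∷ʳ A a = trans (length-++ A) (+-comm (length A) 1)

covered-correct : ∀ A B C a b → length A ≡ length B → Follows C A B →
                  covered A B C a b ≡ conv (A ∷ʳ a) (B ∷ʳ b) (length A)
covered-correct A B C a b l F = begin
  (at C 0 ∨ (b ∧ at A 0)) ∨ (a ∧ at (B ∷ʳ b) 0)
    ≡⟨ cong (λ c → (c ∨ (b ∧ at A 0)) ∨ (a ∧ at (B ∷ʳ b) 0)) (F 0) ⟩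
  (conv A B (length A + 0) ∨ (b ∧ at A 0)) ∨ (a ∧ at (B ∷ʳ b) 0)
    ≡⟨ conv-∷ʳ² A B a b 0 l ⟨
  conv (A ∷ʳ a) (B ∷ʳ b) (length A + 0)
    ≡⟨ cong (conv (A ∷ʳ a) (B ∷ʳ b)) (+-identityʳ (length A)) ⟩
  conv (A ∷ʳ a) (B ∷ʳ b) (length A) ∎
  where open ≡-Reasoning

future-correct : ∀ A B C a b → length A ≡ length B → Follows C A B →
                 Follows (future A B C a b) (A ∷ʳ a) (B ∷ʳ b)
future-correct A B C a b l F j = begin
  at (union (union (tl C) (mask b (tl A))) (mask a (tl (B ∷ʳ b)))) j
    ≡⟨ trans (at-union (union (tl C) (mask b (tl A))) _ j)
             (cong (_∨ at (mask a (tl (B ∷ʳ b))) j) (at-union (tl C) _ j)) ⟩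
  (at (tl C) j ∨ at (mask b (tl A)) j) ∨ at (mask a (tl (B ∷ʳ b))) j
    ≡⟨ cong₂ _∨_ (cong₂ _∨_ (trans (at-tl C j) (F (suc j)))
                            (trans (at-mask b (tl A) j) (cong (b ∧_) (at-tl A j))))
                 (trans (at-mask a (tl (B ∷ʳ b)) j) (cong (a ∧_) (at-tl (B ∷ʳ b) j))) ⟩
  (conv A B (length A + suc j) ∨ (b ∧ at A (suc j))) ∨ (a ∧ at (B ∷ʳ b) (suc j))
    ≡⟨ conv-∷ʳ² A B a b (suc j) l ⟨
  conv (A ∷ʳ a) (B ∷ʳ b) (length A + suc j)
    ≡⟨ cong (conv (A ∷ʳ a) (B ∷ʳ b)) (trans (+-suc (length A) j) (cong (_+ j) (sym (length-∷ʳ A a)))) ⟩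
  conv (A ∷ʳ a) (B ∷ʳ b) (length (A ∷ʳ a) + j) ∎
  where open ≡-Reasoning

-- Whether t is a sum depends only on the bits up to t. Revealing one bit on each side therefore
-- settles the integer t, and the outcome passes into the target.
tally-branch : ∀ T A B C a b r → length A ≡ length B → Follows C A B →
  ∑∑ r (λ A′ B′ → 𝟙 (accepts T (misses (length A) (suc r) (conv (A ++ a ∷ A′) (B ++ b ∷ B′))))) ≡
  tally (advance (covered A B C a b) T) (A ∷ʳ a) (B ∷ʳ b) r
tally-branch T A B C a b r l F = ∑∑-cong r λ A′ B′ _ _ → cong 𝟙 (begin
  accepts T (misses (length A) (suc r) (conv (A ++ a ∷ A′) (B ++ b ∷ B′)))
    ≡⟨ cong₂ (λ A B → accepts T (misses (length′) (suc r) (conv A B))) (sym (++-assoc A (a ∷ []) A′)) (sym (++-assoc B (b ∷ []) B′)) ⟩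
  accepts T (𝟙 (not (conv (A ∷ʳ a ++ A′) (B ∷ʳ b ++ B′) (length A))) + rest A′ B′)
    ≡⟨ cong (λ c → accepts T (𝟙 (not c) + rest A′ B′))
         (trans (conv-++ (A ∷ʳ a) A′ (B ∷ʳ b) B′ (length A)
                   (≤-reflexive (sym (length-∷ʳ A a))) (≤-reflexive (trans (cong suc l) (sym (length-∷ʳ B b)))))
                (sym (covered-correct A B C a b l F))) ⟩
  accepts T (𝟙 (not (covered A B C a b)) + rest A′ B′)
    ≡⟨ accepts-advance (covered A B C a b) T _ ⟩
  accepts (advance (covered A B C a b) T) (misses (suc (length A)) r (conv (A ∷ʳ a ++ A′) (B ∷ʳ b ++ B′)))
    ≡⟨ cong (λ t → accepts (advance (covered A B C a b) T) (misses t r (conv (A ∷ʳ a ++ A′) (B ∷ʳ b ++ B′)))) (sym (length-∷ʳ A a)) ⟩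
  accepts (advance (covered A B C a b) T) (misses (length (A ∷ʳ a)) r (conv (A ∷ʳ a ++ A′) (B ∷ʳ b ++ B′))) ∎)
  where
  open ≡-Reasoning
  length′ = length A
  rest : List Bool → List Bool → ℕ
  rest A′ B′ = misses (suc (length A)) r (conv (A ∷ʳ a ++ A′) (B ∷ʳ b ++ B′))

module Soundness (K : ℕ) where
  open Tree K

  Sound : ℕ → ℕ → Target → List Bool → List Bool → ℕ → Set
  Sound f r T A B u = 16 ^ f * 4 ^ length A * tally T A B r ≤ u * 4 ^ r

  leaf-sound : ∀ f r x T A B C → 0 < length A → length A ≡ length B → Follows C A B →
               Sound f r (x ▹ T) A B (leaf f x (unionBound A B C))
  leaf-sound f r x T A B C 0<A l F = leaf-sound′ x
    where
    open ≤-Reasoning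
    p = proj₁ (unionBound A B C)
    e = proj₂ (unionBound A B C)
    trivial : ∀ T → 4 ^ length A * tally T A B r ≤ p * 4 ^ r
    trivial T = ≤-trans (*-monoʳ-≤ (4 ^ length A) (tally≤4^ T A B r))
                        (≤-reflexive (cong (_* 4 ^ r) (sym (unionBound₁ A B C l))))
    scale : ∀ {x y} → 4 ^ length A * x ≤ y * 4 ^ r → 16 ^ f * 4 ^ length A * x ≤ 16 ^ f * y * 4 ^ r
    scale {x} {y} h = begin
      16 ^ f * 4 ^ length A * x     ≡⟨ *-assoc (16 ^ f) _ _ ⟩
      16 ^ f * (4 ^ length A * x)   ≤⟨ *-monoʳ-≤ (16 ^ f) h ⟩
      16 ^ f * (y * 4 ^ r)          ≡⟨ *-assoc (16 ^ f) _ _ ⟨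
      16 ^ f * y * 4 ^ r            ∎
    minimum : ∀ c → 4 ^ length A * tally (false ▹ T) A B r ≤ (if c then p else e) * 4 ^ r
    minimum true  = trivial (false ▹ T)
    minimum false = ≤-trans (tally≤unionBound T A B C r 0<A l F) (≤-reflexive (*-comm (4 ^ r) e))
    leaf-sound′ : ∀ x → Sound f r (x ▹ T) A B (leaf f x (unionBound A B C))
    leaf-sound′ true  = scale (trivial (true ▹ T))
    leaf-sound′ false = scale (minimum (p <ᵇ e))

  -- Each level costs a factor 16 = 4 · 4: one 4 for averaging over the four children, the other
  -- because the scale `4 ^ length A` of a child is four times that of its parent. By f ≤ r there is
  -- a bit left to reveal at every level.
  bound-sound : ∀ f r T A B C → f ≤ r → 0 < length A → length A ≡ length B → Follows C A B →
                Sound f r T A B (bound f T A B C)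
  bound-sound f r (all-or-none true) A B C f≤r 0<A l F =
    *-monoʳ-≤ (16 ^ f * 4 ^ length A) (tally≤4^ (all-or-none true) A B r)
  bound-sound f r (all-or-none false) A B C f≤r 0<A l F = ≤-reflexive
    (trans (cong (16 ^ f * 4 ^ length A *_) (trans (∑∑-const r 0) (*-zeroʳ (4 ^ r)))) (*-zeroʳ (16 ^ f * 4 ^ length A)))
  bound-sound zero r (x ▹ T) A B C f≤r 0<A l F = leaf-sound zero r x T A B C 0<A l F
  bound-sound (suc f) (suc r) (x ▹ T) A B C (s≤s f≤r) 0<A l F = node-sound (e * K <ᵇ p * p)
    where
    open ≤-Reasoning
    p = proj₁ (unionBound A B C)
    e = proj₂ (unionBound A B C)
    T′ : Bool → Bool → Target
    T′ a b = advance (covered A B C a b) (x ▹ T)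
    sub : Bool → Bool → ℕ
    sub a b = tally (T′ a b) (A ∷ʳ a) (B ∷ʳ b) r
    u : Bool → Bool → ℕ
    u = branch f (x ▹ T) A B C
    s = 16 ^ f * (4 * 4 ^ length A)
    sub-sound : ∀ a b → s * sub a b ≤ u a b * 4 ^ r
    sub-sound a b = subst (λ t → 16 ^ f * 4 ^ t * sub a b ≤ u a b * 4 ^ r) (length-∷ʳ A a)
      (bound-sound f r (T′ a b) (A ∷ʳ a) (B ∷ʳ b) (future A B C a b) f≤r
        (subst (0 <_) (sym (length-∷ʳ A a)) z<s)
        (trans (length-∷ʳ A a) (trans (cong suc l) (sym (length-∷ʳ B b))))
        (future-correct A B C a b l F))
    split : tally (x ▹ T) A B (suc r) ≡ (sub true true + sub true false) + (sub false true + sub false false)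
    split = trans (∑∑-suc r _) (cong₂ _+_ (cong₂ _+_ (part true true) (part true false))
                                          (cong₂ _+_ (part false true) (part false false)))
      where
      part : ∀ a b → _ ≡ sub a b
      part a b = tally-branch (x ▹ T) A B C a b r l F
    distribute : ∀ p q a b c d → 16 * p * q * ((a + b) + (c + d)) ≡
                 4 * ((p * (4 * q) * a + p * (4 * q) * b) + (p * (4 * q) * c + p * (4 * q) * d))
    distribute = solve-∀
    collect : ∀ a b c d p → 4 * ((a * p + b * p) + (c * p + d * p)) ≡ ((a + b) + (c + d)) * (4 * p)
    collect = solve-∀
    node-sound : ∀ c → Sound (suc f) (suc r) (x ▹ T) A B
      (if c then leaf (suc f) x (p , e) else ((u true true + u true false) + (u false true + u false false)))
    node-sound true  = leaf-sound (suc f) (suc r) x T A B C 0<A l F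
    node-sound false = begin
      16 ^ suc f * 4 ^ length A * tally (x ▹ T) A B (suc r)
        ≡⟨ cong (16 ^ suc f * 4 ^ length A *_) split ⟩
      16 ^ suc f * 4 ^ length A * ((sub true true + sub true false) + (sub false true + sub false false))
        ≡⟨ distribute (16 ^ f) (4 ^ length A) (sub true true) (sub true false) (sub false true) (sub false false) ⟩
      4 * ((s * sub true true + s * sub true false) + (s * sub false true + s * sub false false))
        ≤⟨ *-monoʳ-≤ 4 (+-mono-≤ (+-mono-≤ (sub-sound true true) (sub-sound true false))
                                 (+-mono-≤ (sub-sound false true) (sub-sound false false))) ⟩
      4 * ((u true true * 4 ^ r + u true false * 4 ^ r) + (u false true * 4 ^ r + u false false * 4 ^ r))
        ≡⟨ collect (u true true) (u true false) (u false true) (u false false) (4 ^ r) ⟩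
      ((u true true + u true false) + (u false true + u false false)) * 4 ^ suc r ∎

-- Numerical inequalities for r

-- Transfers an inequality α U + β V ≤ γ - 1 / d from the evaluated bounds U = u / s and V = w / s
-- to the frequencies t / M and v / M that they dominate.
scaled-sum : ∀ s d α β γ t v u w M .{{_ : NonZero s}} → s * t ≤ u * M → s * v ≤ w * M →
  d * (α * u + β * w) + s ≤ d * (γ * s) → d * (α * t + β * v) + M ≤ d * (γ * M)
scaled-sum s d α β γ t v u w M st sv h = *-cancelˡ-≤ s (begin
  s * (d * (α * t + β * v) + M)             ≡⟨ expand s d α β t v M ⟩
  d * (α * (s * t) + β * (s * v)) + s * M   ≤⟨ +-monoˡ-≤ (s * M) (*-monoʳ-≤ d (+-mono-≤ (*-monoʳ-≤ α st) (*-monoʳ-≤ β sv))) ⟩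
  d * (α * (u * M) + β * (w * M)) + s * M   ≡⟨ collect s d α β u w M ⟩
  (d * (α * u + β * w) + s) * M             ≤⟨ *-monoˡ-≤ M h ⟩
  d * (γ * s) * M                           ≡⟨ final s d γ M ⟩
  s * (d * (γ * M))                         ∎)
  where
  open ≤-Reasoning
  expand : ∀ s d α β t v M → s * (d * (α * t + β * v) + M) ≡ d * (α * (s * t) + β * (s * v)) + s * M
  expand = solve-∀
  collect : ∀ s d α β u w M → d * (α * (u * M) + β * (w * M)) + s * M ≡ (d * (α * u + β * w) + s) * M
  collect = solve-∀
  final : ∀ s d γ M → d * (γ * s) * M ≡ s * (d * (γ * M))
  final = solve-∀

≤ᵇ-true : ∀ m n → (m ≤ᵇ n) ≡ true → m ≤ n
≤ᵇ-true m n e = ≤ᵇ⇒≤ m n (subst T (sym e) _)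

-- After subtraction of their minima both sets contain 0, so the tree starts from the prefix `𝟏` on
-- either side; `𝟎` records that no integer ≥ 1 is a sum yet.
𝟏 𝟎 : List Bool
𝟏 = true ∷ []
𝟎 = false ∷ []

follows-𝟎 : Follows 𝟎 𝟏 𝟏
follows-𝟎 zero          = refl
follows-𝟎 (suc zero)    = refl
follows-𝟎 (suc (suc j)) = refl

-- 2 ^ 12 is the reciprocal of a lower bound for the margins in the two inequalities for r; the
-- true value of 4 P(r = 2) − P(r = 0) is about 0.05, which dictates the size of K below.
zero? not-two? ≥2? ≥3? : Target
zero?    = true ▹ all-or-none false
not-two? = true ▹ true ▹ false ▹ all-or-none true
≥2?      = false ▹ false ▹ all-or-none true
≥3?      = false ▹ false ▹ false ▹ all-or-none true

module Numerics (K : ℕ) (T T′ : Target) (γ : ℕ) where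
  open Tree K
  open Soundness K

  u w : ℕ
  u = bound 16 T 𝟏 𝟏 𝟎
  w = bound 16 T′ 𝟏 𝟏 𝟎

  -- The tree bounds from above only. Hence 4 P(r = 2) > P(r = 0) is taken as 4 P(r ≠ 2) + P(r = 0)
  -- < 4, and 4 P(r ≤ 2) + P(r ≤ 1) > 4 as 4 P(r ≥ 3) + P(r ≥ 2) < 1. The scale `16 ^ 16 * 4`
  -- belongs to depth 16 and prefixes of length 1, and the summand without the factor `2 ^ 12` is
  -- the margin.
  tally-bound : ((2 ^ 12 * (4 * u + 1 * w) + 16 ^ 16 * 4) ≤ᵇ (2 ^ 12 * (γ * (16 ^ 16 * 4)))) ≡ true →
    ∀ h → 16 ≤ h → 2 ^ 12 * (4 * tally T 𝟏 𝟏 h + 1 * tally T′ 𝟏 𝟏 h) + 4 ^ h ≤ 2 ^ 12 * (γ * 4 ^ h)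
  tally-bound e h 16≤h = scaled-sum (16 ^ 16 * 4) (2 ^ 12) 4 1 γ (tally T 𝟏 𝟏 h) (tally T′ 𝟏 𝟏 h) u w (4 ^ h)
    (bound-sound 16 h T 𝟏 𝟏 𝟎 16≤h z<s refl follows-𝟎) (bound-sound 16 h T′ 𝟏 𝟏 𝟎 16≤h z<s refl follows-𝟎)
    (≤ᵇ-true (2 ^ 12 * (4 * u + 1 * w) + 16 ^ 16 * 4) (2 ^ 12 * (γ * (16 ^ 16 * 4))) e)

opaque
  tally-not-two-zero : ∀ h → 16 ≤ h →
    2 ^ 12 * (4 * tally not-two? 𝟏 𝟏 h + 1 * tally zero? 𝟏 𝟏 h) + 4 ^ h ≤ 2 ^ 12 * (4 * 4 ^ h)
  tally-not-two-zero = Numerics.tally-bound 5000000 not-two? zero? 4 refl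

  tally-≥3-≥2 : ∀ h → 16 ≤ h →
    2 ^ 12 * (4 * tally ≥3? 𝟏 𝟏 h + 1 * tally ≥2? 𝟏 𝟏 h) + 4 ^ h ≤ 2 ^ 12 * (1 * 4 ^ h)
  tally-≥3-≥2 = Numerics.tally-bound 100000 ≥3? ≥2? 1 refl

-- From r to the weights of the values of μ

ν : ℕ → List Bool → List Bool → ℕ
ν h C D = misses 0 (suc h) (conv (true ∷ C) (true ∷ D))

-- 4 (j + 1) / 2 ^ j for j ≤ 2, and an upper bound for it if j ≥ 3: the weight of min A + min B = j.
coef₀ : ℕ → ℕ
coef₀ 0 = 4
coef₀ 1 = 4
coef₀ 2 = 3
coef₀ (suc (suc (suc j))) = 2

-- `coef₀ (m − r)`, and 0 for r > m: if r integers are missing after the shift, μ = m requires min A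
-- + min B = m - r.
coef : ℕ → ℕ → ℕ
coef m       zero    = coef₀ m
coef zero    (suc r) = 0
coef (suc m) (suc r) = coef m r

coef₀≤4 : ∀ j → coef₀ j ≤ 4
coef₀≤4 0 = ≤-refl
coef₀≤4 1 = ≤-refl
coef₀≤4 2 = m≤m+n 3 1
coef₀≤4 (suc (suc (suc j))) = m≤m+n 2 2

coef≤4 : ∀ m r → coef m r ≤ 4
coef≤4 m       zero    = coef₀≤4 m
coef≤4 zero    (suc r) = z≤n
coef≤4 (suc m) (suc r) = coef≤4 m r

-- For m = 1 both sides agree at every r: the two targets are exactly the price for replacing
-- `coef 1` by `coef 2`.
coef-0-1 : ∀ m r → m < 2 → coef m r + 4 ≤ coef 2 r + (4 * 𝟙 (accepts not-two? r) + 1 * 𝟙 (accepts zero? r))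
coef-0-1 0 0 _ = ≤-refl
coef-0-1 0 1 _ = m≤m+n 4 4
coef-0-1 0 2 _ = ≤-refl
coef-0-1 0 (suc (suc (suc r))) _ = ≤-refl
coef-0-1 1 0 _ = ≤-refl
coef-0-1 1 1 _ = ≤-refl
coef-0-1 1 2 _ = ≤-refl
coef-0-1 1 (suc (suc (suc r))) _ = ≤-refl
coef-0-1 (suc (suc m)) r (s≤s (s≤s ()))

-- For r = 0, 1, 2, 3, ... the left coefficients are at most 2, 3, 4, 4, ..., against 3, 4, 4, 0,
-- ... for `coef 2`. The excess, raised by 1, is at most 0, 0, 1, 5, ..., which the two targets
-- supply.
coef-≥3 : ∀ m r → coef (3 + m) r + 1 ≤ coef 2 r + (4 * 𝟙 (accepts ≥3? r) + 1 * 𝟙 (accepts ≥2? r))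
coef-≥3 m       0 = ≤-refl
coef-≥3 zero    1 = ≤-refl
coef-≥3 (suc m) 1 = m≤m+n 3 1
coef-≥3 m       2 = +-monoˡ-≤ 1 (coef₀≤4 (suc m))
coef-≥3 m       (suc (suc (suc r))) = +-monoˡ-≤ 1 (coef≤4 m r)

module _ (h : ℕ) where

  -- Averaging the pointwise inequality over all C and D gives E coef m + γ ≤ E coef 2 + τ, where τ
  -- ≤ γ - 2 ^ -12 is the normalised sum of tallies; subtracting leaves the margin.
  coef-compare : ∀ m γ T T′ → (∀ r → coef m r + γ ≤ coef 2 r + (4 * 𝟙 (accepts T r) + 1 * 𝟙 (accepts T′ r))) →
    2 ^ 12 * (4 * tally T 𝟏 𝟏 h + 1 * tally T′ 𝟏 𝟏 h) + 4 ^ h ≤ 2 ^ 12 * (γ * 4 ^ h) →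
    2 ^ 12 * ∑∑ h (λ C D → coef m (ν h C D)) + 4 ^ h ≤ 2 ^ 12 * ∑∑ h (λ C D → coef 2 (ν h C D))
  coef-compare m γ T T′ pointwise bnd = +-cancelʳ-≤ (2 ^ 12 * t) _ _ (begin
    2 ^ 12 * a + 4 ^ h + 2 ^ 12 * t         ≡⟨ shuffle (2 ^ 12) a (4 ^ h) t ⟩
    2 ^ 12 * a + (2 ^ 12 * t + 4 ^ h)       ≤⟨ +-monoʳ-≤ (2 ^ 12 * a) bnd ⟩
    2 ^ 12 * a + 2 ^ 12 * (γ * 4 ^ h)       ≡⟨ *-distribˡ-+ (2 ^ 12) a _ ⟨
    2 ^ 12 * (a + γ * 4 ^ h)                ≤⟨ *-monoʳ-≤ (2 ^ 12) summed ⟩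
    2 ^ 12 * (b + t)                        ≡⟨ *-distribˡ-+ (2 ^ 12) b t ⟩
    2 ^ 12 * b + 2 ^ 12 * t                 ∎)
    where
    open ≤-Reasoning
    a = ∑∑ h (λ C D → coef m (ν h C D))
    b = ∑∑ h (λ C D → coef 2 (ν h C D))
    t = 4 * tally T 𝟏 𝟏 h + 1 * tally T′ 𝟏 𝟏 h
    shuffle : ∀ p a q t → p * a + q + p * t ≡ p * a + (p * t + q)
    shuffle = solve-∀
    summed : a + γ * 4 ^ h ≤ b + t
    summed = begin
      a + γ * 4 ^ h
        ≡⟨ cong (a +_) (trans (*-comm γ (4 ^ h)) (sym (∑∑-const h γ))) ⟩
      a + ∑∑ h (λ _ _ → γ)
        ≡⟨ ∑∑-+ h _ _ ⟨
      ∑∑ h (λ C D → coef m (ν h C D) + γ)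
        ≤⟨ (∑∑-mono h λ C D _ _ → pointwise (ν h C D)) ⟩
      ∑∑ h (λ C D → coef 2 (ν h C D) + (4 * 𝟙 (accepts T (ν h C D)) + 1 * 𝟙 (accepts T′ (ν h C D))))
        ≡⟨ ∑∑-+ h _ _ ⟩
      b + ∑∑ h (λ C D → 4 * 𝟙 (accepts T (ν h C D)) + 1 * 𝟙 (accepts T′ (ν h C D)))
        ≡⟨ cong (b +_) (trans (∑∑-+ h _ _) (cong₂ _+_ (∑∑-*ˡ h 4 _) (∑∑-*ˡ h 1 _))) ⟩
      b + t ∎

  coef-gap : 16 ≤ h → ∀ m → m ≢ 2 →
    2 ^ 12 * ∑∑ h (λ C D → coef m (ν h C D)) + 4 ^ h ≤ 2 ^ 12 * ∑∑ h (λ C D → coef 2 (ν h C D))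
  coef-gap 16≤h 0 _ = coef-compare 0 4 not-two? zero? (λ r → coef-0-1 0 r z<s) (tally-not-two-zero h 16≤h)
  coef-gap 16≤h 1 _ = coef-compare 1 4 not-two? zero? (λ r → coef-0-1 1 r (s≤s z<s)) (tally-not-two-zero h 16≤h)
  coef-gap 16≤h 2 2≢2 = contradiction refl 2≢2
  coef-gap 16≤h (suc (suc (suc m))) _ = coef-compare (3 + m) 1 ≥3? ≥2? (coef-≥3 m) (tally-≥3-≥2 h 16≤h)

-- Differences that are bounded away from n are rarely missing

at-reverse : ∀ S x y {N} → length S ≡ suc N → x + y ≡ N → at (reverse S) y ≡ at S x
at-reverse (a ∷ S) zero y l e = begin
  at (reverse (a ∷ S)) y                     ≡⟨ cong (λ R → at R y) (unfold-reverse a S) ⟩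
  at (reverse S ∷ʳ a) y                      ≡⟨ cong (at (reverse S ∷ʳ a)) y≡ ⟩
  at (reverse S ∷ʳ a) (length (reverse S) + 0) ≡⟨ at-++ʳ (reverse S) (a ∷ []) 0 ⟩
  a                                          ∎
  where
  open ≡-Reasoning
  y≡ : y ≡ length (reverse S) + 0
  y≡ = trans e (trans (sym (suc-injective l)) (trans (sym (length-reverse S)) (sym (+-identityʳ _))))
at-reverse (a ∷ a′ ∷ S) (suc x) y {suc N} l e = begin
  at (reverse (a ∷ a′ ∷ S)) y       ≡⟨ cong (λ R → at R y) (unfold-reverse a (a′ ∷ S)) ⟩
  at (reverse (a′ ∷ S) ∷ʳ a) y      ≡⟨ at-++ˡ (reverse (a′ ∷ S)) (a ∷ []) y y<S ⟩
  at (reverse (a′ ∷ S)) y           ≡⟨ at-reverse (a′ ∷ S) x y (suc-injective l) (suc-injective e) ⟩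
  at (a′ ∷ S) x                     ∎
  where
  open ≡-Reasoning
  y<S : y < length (reverse (a′ ∷ S))
  y<S = subst (y <_) (sym (trans (length-reverse (a′ ∷ S)) (suc-injective l)))
          (s≤s (≤-trans (m≤n+m y x) (≤-reflexive (suc-injective e))))
at-reverse (a ∷ []) (suc x) y {zero} l ()

differs : ℕ → List Bool → Bool
differs d []      = false
differs d (a ∷ S) = (a ∧ at (a ∷ S) d) ∨ differs d S

differs⁻ : ∀ d S → differs d S ≡ true → ∃[ x ] (at S x ≡ true × at S (x + d) ≡ true)
differs⁻ d (a ∷ S) e with ∨-true⁻ (a ∧ at (a ∷ S) d) e
... | inj₁ e₁ = let ea , ed = ∧-true⁻ a e₁ in 0 , ea , ed
... | inj₂ e₂ = let x , ex , ed = differs⁻ d S e₂ in suc x , ex , ed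

differs⁺ : ∀ d S x → at S x ≡ true → at S (x + d) ≡ true → differs d S ≡ true
differs⁺ d (a ∷ S) zero    ex ed rewrite ex | ed = refl
differs⁺ d (a ∷ S) (suc x) ex ed rewrite differs⁺ d S x ex ed = ∨-zeroʳ _

differs-++ʳ : ∀ d R S → differs d S ≡ true → differs d (R ++ S) ≡ true
differs-++ʳ d []      S e = e
differs-++ʳ d (a ∷ R) S e rewrite differs-++ʳ d R S e = ∨-zeroʳ _

-- Reversal sends y to N - y, so the sumset of S and its reversal is N + (S - S), and a sum i
-- corresponds to the difference N - i.
differs⇔conv : ∀ S {N} d i → length S ≡ suc N → i + d ≡ N → conv S (reverse S) i ≡ differs d S
differs⇔conv S {N} d i l e = ≡-from-⇔ to from
  where
  to : conv S (reverse S) i ≡ true → differs d S ≡ true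
  to c = let x , y , s , ex , ey = conv⁻ S (reverse S) i c in
    differs⁺ d S x ex (trans (sym (at-reverse S (x + d) y l (trans (rearrange x d y) (trans (cong (_+ d) s) e)))) ey)
    where
    rearrange : ∀ x d y → x + d + y ≡ x + y + d
    rearrange = solve-∀
  from : differs d S ≡ true → conv S (reverse S) i ≡ true
  from c = let x , ex , ed = differs⁻ d S c
               x+d<n = subst (x + d <_) l (at⇒< S (x + d) ed)
               y = N ∸ (x + d)
               s : x + d + y ≡ N
               s = m+[n∸m]≡n (s≤s⁻¹ x+d<n)
           in subst (λ i → conv S (reverse S) i ≡ true)
                (+-cancelʳ-≡ d _ _ (trans (rearrange x y d) (trans s (sym e))))
                (conv⁺ S (reverse S) x y ex (trans (at-reverse S (x + d) y l s) ed))
    where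
    rearrange : ∀ x y d → x + y + d ≡ x + d + y
    rearrange = solve-∀

avoiding : ℕ → ℕ → ℕ
avoiding d n = ∑ n (λ S → 𝟙 (not (differs d S)))

avoiding≤ : ∀ d n → avoiding d n ≤ 2 ^ n
avoiding≤ d n = ≤-trans (∑-mono n λ _ _ → 𝟙≤1 _) (≤-reflexive (trans (∑-const n 1) (*-identityʳ _)))

-- Corresponding letters of X and Z lie at distance d = suc k + c, which gives suc k disjoint pairs
-- that must all avoid (1, 1); V contributes an independent factor. Reversing Z turns equal
-- positions into positions with sum k, so that `∑∑-avoid` does the counting.
avoiding-block : ∀ k c v → avoiding (suc k + c) (suc k + (c + (suc k + v))) ≤ 3 ^ suc k * 2 ^ c * avoiding (suc k + c) v
avoiding-block k c v = begin
  ∑ (g + (c + (g + v))) W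
    ≡⟨ ∑-++ g _ W ⟩
  ∑ g (λ X → ∑ (c + (g + v)) (λ R → W (X ++ R)))
    ≡⟨ (∑-cong g λ X _ → trans (∑-++ c _ _) (∑-cong c λ Y _ → ∑-++ g v _)) ⟩
  ∑ g (λ X → ∑ c (λ Y → ∑ g (λ Z → ∑ v (λ V → W (X ++ (Y ++ (Z ++ V)))))))
    ≤⟨ (∑-mono g λ X lX → ∑-mono c λ Y lY → ∑-mono g λ Z lZ → ∑-mono v λ V _ →
         𝟙-not-* {conv X (reverse Z) k} (paired X Y Z V lX lY lZ)
                 (𝟙-not-mono {differs d V} λ e → differs-++ʳ d X _ (differs-++ʳ d Y _ (differs-++ʳ d Z V e)))) ⟩
  ∑ g (λ X → ∑ c (λ Y → ∑ g (λ Z → ∑ v (λ V → f X Z * W V))))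
    ≡⟨ (∑-cong g λ X _ → trans (∑-cong c λ Y _ → ∑-product g v (f X) W) (∑-const c _)) ⟩
  ∑ g (λ X → 2 ^ c * (∑ g (f X) * ∑ v W))
    ≡⟨ trans (∑-*ˡ g (2 ^ c) _) (cong (2 ^ c *_) (∑-*ʳ g (∑ v W) _)) ⟩
  2 ^ c * (∑∑ g f * ∑ v W)
    ≡⟨ cong (λ s → 2 ^ c * (s * ∑ v W)) (trans (∑-cong g λ X _ → ∑-reverse g (λ Z → 𝟙 (not (conv X Z k)))) (∑∑-avoid k)) ⟩
  2 ^ c * (3 ^ g * ∑ v W)
    ≡⟨ shuffle (2 ^ c) (3 ^ g) _ ⟩
  3 ^ g * 2 ^ c * avoiding d v ∎
  where
  open ≤-Reasoning
  g = suc k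
  d = suc k + c
  W : List Bool → ℕ
  W S = 𝟙 (not (differs d S))
  f : List Bool → List Bool → ℕ
  f X Z = 𝟙 (not (conv X (reverse Z) k))
  shuffle : ∀ p q r → p * (q * r) ≡ q * p * r
  shuffle = solve-∀
  position : ∀ g c x → g + (c + x) ≡ x + (g + c)
  position = solve-∀
  paired : ∀ X Y Z V → length X ≡ g → length Y ≡ c → length Z ≡ g →
           conv X (reverse Z) k ≡ true → differs d (X ++ (Y ++ (Z ++ V))) ≡ true
  paired X Y Z V lX lY lZ e = let x , y , s , ex , ey = conv⁻ X (reverse Z) k e in
    differs⁺ d (X ++ (Y ++ (Z ++ V))) x (at-++⁺ˡ X _ x ex)
      (subst (λ i → at (X ++ (Y ++ (Z ++ V))) i ≡ true) (position g c x)
        (at-++⁺ʳ X _ (c + x) lX (at-++⁺ʳ Y _ x lY (at-++⁺ˡ Z V x (trans (sym (at-reverse Z x y lZ s)) ey)))))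

-- The g pairs (x, x + d) with x < g ≤ d are disjoint, so a single block suffices.
avoiding-far : ∀ g d n → g ≤ d → d + g ≤ n → 4 ^ g * avoiding d n ≤ 3 ^ g * 2 ^ n
avoiding-far zero    d n g≤d d+g≤n = *-monoʳ-≤ 1 (avoiding≤ d n)
avoiding-far (suc k) d n g≤d d+g≤n = begin
  4 ^ g * avoiding d n
    ≡⟨ cong₂ (λ d n → 4 ^ g * avoiding d n) (sym d≡) (sym n≡) ⟩
  4 ^ g * avoiding (g + c) (g + (c + (g + v)))
    ≤⟨ *-monoʳ-≤ (4 ^ g) (≤-trans (avoiding-block k c v) (*-monoʳ-≤ (3 ^ g * 2 ^ c) (avoiding≤ (g + c) v))) ⟩
  4 ^ g * (3 ^ g * 2 ^ c * 2 ^ v)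
    ≡⟨ cong (_* (3 ^ g * 2 ^ c * 2 ^ v)) (2^*2^ g) ⟨
  2 ^ g * 2 ^ g * (3 ^ g * 2 ^ c * 2 ^ v)
    ≡⟨ shuffle (2 ^ g) (3 ^ g) (2 ^ c) (2 ^ v) ⟩
  3 ^ g * (2 ^ g * (2 ^ c * (2 ^ g * 2 ^ v)))
    ≡⟨ cong (3 ^ g *_) (trans (^-distribˡ-+-* 2 g (c + (g + v))) (cong (2 ^ g *_)
         (trans (^-distribˡ-+-* 2 c (g + v)) (cong (2 ^ c *_) (^-distribˡ-+-* 2 g v))))) ⟨
  3 ^ g * 2 ^ (g + (c + (g + v)))
    ≡⟨ cong (λ n → 3 ^ g * 2 ^ n) n≡ ⟩
  3 ^ g * 2 ^ n ∎
  where
  open ≤-Reasoning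
  g = suc k
  c = d ∸ g
  v = n ∸ (d + g)
  d≡ : g + c ≡ d
  d≡ = m+[n∸m]≡n g≤d
  regroup : ∀ g c v → g + (c + (g + v)) ≡ (g + c) + g + v
  regroup = solve-∀
  n≡ : g + (c + (g + v)) ≡ n
  n≡ = trans (regroup g c v) (trans (cong (λ d → d + g + v) d≡) (m+[n∸m]≡n d+g≤n))
  shuffle : ∀ p q r s → p * p * (q * r * s) ≡ q * (p * (r * (p * s)))
  shuffle = solve-∀

-- For d < g the pairs (x, x + d) with x < g overlap. Instead, blocks of length 2 d are cut off,
-- each with d disjoint pairs, until at most d more pairs are required. A block lowers g by d and n
-- by 2 d, which preserves the size condition; `fuel` bounds the number of blocks.
avoiding-near : ∀ fuel g d n → g ≤ fuel → 0 < d → (g + g) + (d + d) ≤ n → 4 ^ g * avoiding d n ≤ 3 ^ g * 2 ^ n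
avoiding-near fuel g d n g≤fuel 0<d size with g ≤? d
... | yes g≤d = avoiding-far g d n g≤d (≤-trans (≤-trans (≤-reflexive (+-comm d g)) (+-mono-≤ (m≤m+n g g) (m≤m+n d d))) size)
avoiding-near zero g d n g≤fuel 0<d size | no g≰d = contradiction (≤-trans g≤fuel z≤n) g≰d
avoiding-near (suc fuel) g (suc k) n g≤fuel 0<d size | no g≰d = begin
  4 ^ g * avoiding d n
    ≡⟨ cong₂ (λ g n → 4 ^ g * avoiding d n) g≡ n≡ ⟨
  4 ^ (d + g′) * avoiding d (d + (0 + (d + v)))
    ≤⟨ *-monoʳ-≤ (4 ^ (d + g′)) (subst (λ e → avoiding e (d + (0 + (d + v))) ≤ 3 ^ d * 1 * avoiding e v) (+-identityʳ d) (avoiding-block k 0 v)) ⟩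
  4 ^ (d + g′) * (3 ^ d * 1 * avoiding d v)
    ≡⟨ cong (_* (3 ^ d * 1 * avoiding d v)) (^-distribˡ-+-* 4 d g′) ⟩
  4 ^ d * 4 ^ g′ * (3 ^ d * 1 * avoiding d v)
    ≡⟨ shuffle (4 ^ d) (4 ^ g′) (3 ^ d) _ ⟩
  4 ^ d * 3 ^ d * (4 ^ g′ * avoiding d v)
    ≤⟨ *-monoʳ-≤ (4 ^ d * 3 ^ d) (avoiding-near fuel g′ d v g′≤fuel 0<d size′) ⟩
  4 ^ d * 3 ^ d * (3 ^ g′ * 2 ^ v)
    ≡⟨ cong (λ p → p * 3 ^ d * (3 ^ g′ * 2 ^ v)) (2^*2^ d) ⟨
  2 ^ d * 2 ^ d * 3 ^ d * (3 ^ g′ * 2 ^ v)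
    ≡⟨ shuffle′ (2 ^ d) (3 ^ d) (3 ^ g′) (2 ^ v) ⟩
  3 ^ d * 3 ^ g′ * (2 ^ d * (2 ^ d * 2 ^ v))
    ≡⟨ cong₂ _*_ (^-distribˡ-+-* 3 d g′) (trans (^-distribˡ-+-* 2 d (d + v)) (cong (2 ^ d *_) (^-distribˡ-+-* 2 d v))) ⟨
  3 ^ (d + g′) * 2 ^ (d + (0 + (d + v)))
    ≡⟨ cong₂ (λ g n → 3 ^ g * 2 ^ n) g≡ n≡ ⟩
  3 ^ g * 2 ^ n ∎
  where
  open ≤-Reasoning
  d = suc k
  g′ = g ∸ d
  v = n ∸ (d + d)
  g≡ : d + g′ ≡ g
  g≡ = m+[n∸m]≡n (<⇒≤ (≰⇒> g≰d))
  n≡ : d + (0 + (d + v)) ≡ n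
  n≡ = trans (sym (+-assoc d d v)) (m+[n∸m]≡n (≤-trans (m≤n+m (d + d) (g + g)) size))
  g′≤fuel : g′ ≤ fuel
  g′≤fuel = s≤s⁻¹ (≤-trans (s≤s (m≤n+m g′ k)) (≤-trans (≤-reflexive g≡) g≤fuel))
  regroup : ∀ d g → (g + g) + (d + d) + (d + d) ≡ ((d + g) + (d + g)) + (d + d)
  regroup = solve-∀
  size′ : (g′ + g′) + (d + d) ≤ v
  size′ = m+n≤o⇒m≤o∸n _ (≤-trans (≤-reflexive (trans (regroup d g′) (cong (λ g → (g + g) + (d + d)) g≡))) size)
  shuffle : ∀ a b c x → a * b * (c * 1 * x) ≡ a * c * (b * x)
  shuffle = solve-∀
  shuffle′ : ∀ p q r s → p * p * q * (r * s) ≡ q * r * (p * (p * s))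
  shuffle′ = solve-∀

bad : ℕ → ℕ → List Bool → ℕ
bad g b S = misses g b (conv S (reverse S))

-- Union bound over the differences 1, ..., b, each missing with probability at most (3/4) ^ g.
-- Those below g need several blocks, and 4 g ≤ n provides the room.
∑-bad : ∀ g b → (g + g) + (g + g) ≤ suc (g + b) →
        4 ^ g * ∑ (suc (g + b)) (bad g b) ≤ b * (3 ^ g * 2 ^ suc (g + b))
∑-bad g b 4g≤n = begin
  4 ^ g * ∑ n (bad g b)
    ≡⟨ cong (4 ^ g *_) (trans (∑-cong n λ S _ → misses-sum< g b _) (∑-sum< n b _)) ⟩
  4 ^ g * sum< b (λ j → ∑ n (λ S → 𝟙 (not (conv S (reverse S) (g + j)))))
    ≡⟨ sum<-*ˡ b (4 ^ g) _ ⟨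
  sum< b (λ j → 4 ^ g * ∑ n (λ S → 𝟙 (not (conv S (reverse S) (g + j)))))
    ≤⟨ sum<-mono b single ⟩
  sum< b (λ _ → 3 ^ g * 2 ^ n)
    ≡⟨ sum<-const b _ ⟩
  b * (3 ^ g * 2 ^ n) ∎
  where
  open ≤-Reasoning
  n = suc (g + b)
  single : ∀ j → j < b → 4 ^ g * ∑ n (λ S → 𝟙 (not (conv S (reverse S) (g + j)))) ≤ 3 ^ g * 2 ^ n
  single j j<b = ≤-trans
    (≤-reflexive (cong (4 ^ g *_) (∑-cong n λ S l → cong (𝟙 ∘ not)
      (differs⇔conv S d (g + j) l (trans (+-assoc g j d) (cong (g +_) j+d≡b))))))
    (avoid (g ≤? d))
    where
    d = b ∸ j
    j+d≡b : j + d ≡ b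
    j+d≡b = m+[n∸m]≡n (<⇒≤ j<b)
    avoid : _ → 4 ^ g * avoiding d n ≤ 3 ^ g * 2 ^ n
    avoid (yes g≤d) = avoiding-far g d n g≤d
      (≤-trans (≤-trans (+-monoˡ-≤ g (m∸n≤m b j)) (≤-reflexive (+-comm b g))) (n≤1+n _))
    avoid (no g≰d)  = avoiding-near g g d n ≤-refl (m<n⇒0<n∸m j<b)
      (≤-trans (+-monoʳ-≤ (g + g) (+-mono-≤ d≤g d≤g)) 4g≤n)
      where d≤g = <⇒≤ (≰⇒> g≰d)

-- Splitting off the leading zeros on both sides

-- C is kept apart from V because, outside the bad event, μ depends on this side only through x and
-- C; V is summed away.
word : ℕ → List Bool → List Bool → List Bool
word x C V = replicate x false ++ true ∷ (C ++ V)

-- A word has either some x < k leading zeros followed by a one, with 2 ^ (k - 1 - x) choices of V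
-- for given x and C, or k leading zeros. The error G remains a sum over whole words, so applying
-- this to both ends of S still produces a single sum of errors.
∑-word-≤ : ∀ k h (f : ℕ → List Bool → ℕ) (F G : List Bool → ℕ) →
  (∀ x C V → x < k → length C ≡ h → length V ≡ k ∸ suc x → F (word x C V) ≤ f x C + G (word x C V)) →
  (∀ v → length v ≡ h → F (replicate k false ++ v) ≤ G (replicate k false ++ v)) →
  ∑ (k + h) F ≤ sum< k (λ x → 2 ^ (k ∸ suc x) * ∑ h (f x)) + ∑ (k + h) G
∑-word-≤ zero    h f F G F≤f+G F≤G = ≤-trans (∑-mono h F≤G) (m≤n+m (∑ h G) _)
∑-word-≤ (suc k) h f F G F≤f+G F≤G = begin
  ∑ (suc k + h) F
    ≡⟨ ∑-suc (k + h) F ⟩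
  ∑ (k + h) (F ∘ (true ∷_)) + ∑ (k + h) (F ∘ (false ∷_))
    ≤⟨ +-mono-≤ ones (∑-word-≤ k h (f ∘ suc) (F ∘ (false ∷_)) (G ∘ (false ∷_))
                        (λ x C V x<k → F≤f+G (suc x) C V (s≤s x<k)) F≤G) ⟩
  (2 ^ k * ∑ h (f 0) + ∑ (k + h) (G ∘ (true ∷_))) + (sum< k (λ x → 2 ^ (k ∸ suc x) * ∑ h (f (suc x))) + ∑ (k + h) (G ∘ (false ∷_)))
    ≡⟨ +-interchange (2 ^ k * ∑ h (f 0)) _ _ _ ⟩
  (2 ^ k * ∑ h (f 0) + sum< k (λ x → 2 ^ (k ∸ suc x) * ∑ h (f (suc x)))) + (∑ (k + h) (G ∘ (true ∷_)) + ∑ (k + h) (G ∘ (false ∷_)))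
    ≡⟨ cong (_+ (∑ (k + h) (G ∘ (true ∷_)) + ∑ (k + h) (G ∘ (false ∷_)))) (sum<-suc k (λ x → 2 ^ (suc k ∸ suc x) * ∑ h (f x))) ⟨
  sum< (suc k) (λ x → 2 ^ (suc k ∸ suc x) * ∑ h (f x)) + (∑ (k + h) (G ∘ (true ∷_)) + ∑ (k + h) (G ∘ (false ∷_)))
    ≡⟨ cong (sum< (suc k) (λ x → 2 ^ (suc k ∸ suc x) * ∑ h (f x)) +_) (∑-suc (k + h) G) ⟨
  sum< (suc k) (λ x → 2 ^ (suc k ∸ suc x) * ∑ h (f x)) + ∑ (suc k + h) G ∎
  where
  open ≤-Reasoning
  ones : ∑ (k + h) (F ∘ (true ∷_)) ≤ 2 ^ k * ∑ h (f 0) + ∑ (k + h) (G ∘ (true ∷_))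
  ones = subst (λ n → ∑ n (F ∘ (true ∷_)) ≤ 2 ^ k * ∑ h (f 0) + ∑ n (G ∘ (true ∷_))) (+-comm h k) (begin
    ∑ (h + k) (F ∘ (true ∷_))
      ≡⟨ ∑-++ h k _ ⟩
    ∑ h (λ C → ∑ k (λ V → F (word 0 C V)))
      ≤⟨ (∑-mono h λ C lC → ∑-mono k λ V lV → F≤f+G 0 C V z<s lC lV) ⟩
    ∑ h (λ C → ∑ k (λ V → f 0 C + G (word 0 C V)))
      ≡⟨ (∑-cong h λ C _ → trans (∑-+ k _ _) (cong (_+ ∑ k (λ V → G (word 0 C V))) (∑-const k (f 0 C)))) ⟩
    ∑ h (λ C → 2 ^ k * f 0 C + ∑ k (λ V → G (word 0 C V)))
      ≡⟨ trans (∑-+ h _ _) (cong₂ _+_ (∑-*ˡ h (2 ^ k) (f 0)) (sym (∑-++ h k (G ∘ (true ∷_))))) ⟩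
    2 ^ k * ∑ h (f 0) + ∑ (h + k) (G ∘ (true ∷_)) ∎)

∑-word-≥ : ∀ k h (f : ℕ → List Bool → ℕ) (H : List Bool → ℕ) →
  (∀ x C V → x < k → length C ≡ h → length V ≡ k ∸ suc x → f x C ≤ H (word x C V)) →
  sum< k (λ x → 2 ^ (k ∸ suc x) * ∑ h (f x)) ≤ ∑ (k + h) H
∑-word-≥ zero    h f H f≤H = ≤-trans (≤-reflexive (sum<-zero _)) z≤n
∑-word-≥ (suc k) h f H f≤H = ≤-trans (≤-trans (≤-reflexive (sum<-suc k _))
  (+-mono-≤ ones (∑-word-≥ k h (f ∘ suc) (H ∘ (false ∷_)) (λ x C V x<k → f≤H (suc x) C V (s≤s x<k)))))
  (≤-reflexive (sym (∑-suc (k + h) H)))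
  where
  open ≤-Reasoning
  ones : 2 ^ k * ∑ h (f 0) ≤ ∑ (k + h) (H ∘ (true ∷_))
  ones = subst (λ n → 2 ^ k * ∑ h (f 0) ≤ ∑ n (H ∘ (true ∷_))) (+-comm h k) (begin
    2 ^ k * ∑ h (f 0)
      ≡⟨ ∑-*ˡ h (2 ^ k) (f 0) ⟨
    ∑ h (λ C → 2 ^ k * f 0 C)
      ≡⟨ (∑-cong h λ C _ → ∑-const k (f 0 C)) ⟨
    ∑ h (λ C → ∑ k (λ _ → f 0 C))
      ≤⟨ (∑-mono h λ C lC → ∑-mono k λ V lV → f≤H 0 C V z<s lC lV) ⟩
    ∑ h (λ C → ∑ k (λ V → H (word 0 C V)))
      ≡⟨ ∑-++ h k _ ⟨
    ∑ (h + k) (H ∘ (true ∷_)) ∎)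

conv-shift : ∀ x y X Y i → conv (replicate x false ++ X) (replicate y false ++ Y) (x + y + i) ≡ conv X Y i
conv-shift zero    zero    X Y i = refl
conv-shift zero    (suc y) X Y i = trans (conv-∷ X false _ (y + i)) (conv-shift zero y X Y i)
conv-shift (suc x) y       X Y i = conv-shift x y X Y i

conv-initial : ∀ x y X Y i → i < x + y → conv (replicate x false ++ X) (replicate y false ++ Y) i ≡ false
conv-initial zero    (suc y) X Y zero    _           = trans (conv-zero X _) (∧-zeroʳ (at X 0))
conv-initial zero    (suc y) X Y (suc i) (s≤s i<y)   = trans (conv-∷ X false _ i) (conv-initial zero y X Y i i<y)
conv-initial (suc x) y       X Y zero    _           = refl
conv-initial (suc x) y       X Y (suc i) (s≤s i<x+y) = conv-initial x y X Y i i<x+y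

misses≡0⇒ : ∀ t r p → misses t r p ≡ 0 → ∀ i → t ≤ i → i < t + r → p i ≡ true
misses≡0⇒ t zero    p e i t≤i i<t = contradiction (≤-trans i<t (≤-reflexive (+-identityʳ t))) (≤⇒≯ t≤i)
misses≡0⇒ t (suc r) p e i t≤i i<t+r with m≤n⇒m<n∨m≡n t≤i
... | inj₁ t<i  = misses≡0⇒ (suc t) r p (m+n≡0⇒n≡0 (𝟙 (not (p t))) e) i t<i (subst (i <_) (+-suc t r) i<t+r)
... | inj₂ refl = present (p t) (m+n≡0⇒m≡0 (𝟙 (not (p t))) e)
  where
  present : ∀ b → 𝟙 (not b) ≡ 0 → b ≡ true
  present true e = refl

misses-true : ∀ t r {p} → (∀ i → t ≤ i → i < t + r → p i ≡ true) → misses t r p ≡ 0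
misses-true t r p≡true = trans (misses-cong t r p≡true) (const-true t r)
  where
  const-true : ∀ t r → misses t r (λ _ → true) ≡ 0
  const-true t zero    = refl
  const-true t (suc r) = const-true (suc t) r

misses-false : ∀ t r {p} → (∀ i → t ≤ i → i < t + r → p i ≡ false) → misses t r p ≡ r
misses-false t r p≡false = trans (misses-cong t r p≡false) (const-false t r)
  where
  const-false : ∀ t r → misses t r (λ _ → false) ≡ r
  const-false t zero    = refl
  const-false t (suc r) = cong suc (const-false (suc t) r)

misses-shift : ∀ j r p → misses j r p ≡ misses 0 r (λ i → p (j + i))
misses-shift j r p = trans (misses-sum< j r p) (sym (misses-sum< 0 r (λ i → p (j + i))))

-- The two ends of a subset

-- S consists of A, M and the reversal of B, with A and B of length L = 2 g and n = 4 g + ρ. For i <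
-- 2 g only the independent words A and B matter. Writing L as `suc g + h` fits `word`: at most g
-- leading zeros, a one, and h bits for C.
module Fringe (h ρ : ℕ) where

  g L b n : ℕ
  g = suc h
  L = suc g + h
  b = h + (ρ + L)
  n = suc (g + b)

  n≡ : n ≡ L + (ρ + L)
  n≡ = cong (2 +_) (sym (+-assoc h h (ρ + L)))

  μ : List Bool → ℕ
  μ S = misses 0 (g + b) (conv S (reverse S))

  μ≡ : ∀ S → bad g b S ≡ 0 → μ S ≡ misses 0 g (conv S (reverse S))
  μ≡ S e = trans (misses-+ 0 g b (conv S (reverse S))) (trans (cong (misses 0 g (conv S (reverse S)) +_) e) (+-identityʳ _))

  join : List Bool → List Bool → List Bool → List Bool
  join M A B = A ++ (M ++ reverse B)

  conv-join : ∀ M A B i → i < length A → i < length B → conv (join M A B) (reverse (join M A B)) i ≡ conv A B i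
  conv-join M A B i i<A i<B = trans
    (cong (λ R → conv (join M A B) R i)
      (trans (reverse-++ A (M ++ reverse B)) (trans (cong (_++ reverse A) (reverse-++ M (reverse B)))
        (trans (cong (λ R → (R ++ reverse M) ++ reverse A) (reverse-involutive B)) (++-assoc B (reverse M) (reverse A))))))
    (conv-++ A _ B _ i i<A i<B)

  g<b : g < b
  g<b = ≤-trans (m≤m+n (suc g) h) (≤-trans (m≤n+m L ρ) (m≤n+m (ρ + L) h))

  length-word : ∀ x C V → x < suc g → length C ≡ h → length V ≡ g ∸ x → length (word x C V) ≡ g + g
  length-word x C V (s≤s x≤g) lC lV = begin
    length (word x C V)                        ≡⟨ length-++ (replicate x false) ⟩
    length (replicate x false) + suc (length (C ++ V)) ≡⟨ cong₂ (λ a b → a + suc b) (length-replicate x) (length-++ C) ⟩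
    x + suc (length C + length V)              ≡⟨ cong₂ (λ c v → x + suc (c + v)) lC lV ⟩
    x + (g + (g ∸ x))                          ≡⟨ lemma x g (g ∸ x) ⟩
    g + (x + (g ∸ x))                          ≡⟨ cong (g +_) (m+[n∸m]≡n x≤g) ⟩
    g + g                                      ∎
    where
    open ≡-Reasoning
    lemma : ∀ x g e → x + (g + e) ≡ g + (x + e)
    lemma = solve-∀

  module _ (M : List Bool) (x : ℕ) (C V : List Bool) (x≤g : x < suc g) (lC : length C ≡ h) (lV : length V ≡ g ∸ x)
           (y : ℕ) (D W : List Bool) (y≤g : y < suc g) (lD : length D ≡ h) (lW : length W ≡ g ∸ y) where

    private
      A B S : List Bool
      A = word x C V
      B = word y D W
      S = join M A B
      p : ℕ → Bool
      p = conv S (reverse S)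
      p-conv : ∀ i → i < g + g → p i ≡ conv A B i
      p-conv i i<2g = conv-join M A B i (subst (i <_) (sym (length-word x C V x≤g lC lV)) i<2g)
                                        (subst (i <_) (sym (length-word y D W y≤g lD lW)) i<2g)
      q : ℕ → Bool
      q = conv (true ∷ (C ++ V)) (true ∷ (D ++ W))

    -- All integers below x + y are missing, so x + y ≤ g because g itself is present. The missing
    -- integers from x + y on are those of the shifted sum.
    μ-word : bad g b S ≡ 0 → μ S ≡ x + y + ν h C D
    μ-word e₀ = trans (μ≡ S e₀) (by-cases (x + y ≤? g))
      where
      open ≡-Reasoning
      full : ∀ i → g ≤ i → i < g + b → p i ≡ true
      full = misses≡0⇒ g b p e₀
      true≢false : true ≢ false
      true≢false ()
      by-cases : _ → misses 0 g p ≡ x + y + ν h C D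
      by-cases (no  x+y≰g) = contradiction
        (trans (sym (full g ≤-refl (m<m+n g (≤-trans (s≤s z≤n) g<b))))
               (trans (p-conv g (m<m+n g z<s)) (conv-initial x y _ _ g (≰⇒> x+y≰g)))) true≢false
      by-cases (yes x+y≤g) = begin
        misses 0 g p                            ≡⟨ cong (λ k → misses 0 k p) j+e ⟨
        misses 0 (j + e) p                      ≡⟨ misses-+ 0 j e p ⟩
        misses 0 j p + misses j e p             ≡⟨ cong₂ _+_ (misses-false 0 j initial) (trans (misses-shift j e p) (misses-cong 0 e (λ i _ i<e → shifted i (g<2g i i<e)))) ⟩
        j + misses 0 e q                        ≡⟨ cong (j +_) (+-identityʳ _) ⟨
        -- Shifted by j, the integers from e to g - 1 land at or above g, where everything is
        -- present. Including them extends the range to all integers below g, where q depends only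
        -- on C and D.
        j + (misses 0 e q + 0)                  ≡⟨ cong (λ k → j + (misses 0 e q + k)) (misses-true e j final) ⟨
        j + (misses 0 e q + misses e j q)       ≡⟨ cong (j +_) (misses-+ 0 e j q) ⟨
        j + misses 0 (e + j) q                  ≡⟨ cong (λ k → j + misses 0 k q) (trans (+-comm e j) j+e) ⟩
        j + misses 0 g q                        ≡⟨ cong (j +_) (misses-cong 0 g λ i _ i<g →
                                                     conv-++ (true ∷ C) V (true ∷ D) W i (subst (i <_) (cong suc (sym lC)) i<g)
                                                                                         (subst (i <_) (cong suc (sym lD)) i<g)) ⟩
        j + ν h C D                             ∎
        where
        j = x + y
        e = g ∸ j
        j+e : j + e ≡ g
        j+e = m+[n∸m]≡n x+y≤g
        g<2g : ∀ i → i < e → j + i < g + g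
        g<2g i i<e = ≤-trans (+-monoʳ-< j i<e) (≤-trans (≤-reflexive j+e) (m≤m+n g g))
        initial : ∀ i → 0 ≤ i → i < j → p i ≡ false
        initial i _ i<j = trans (p-conv i (≤-trans i<j (≤-trans x+y≤g (m≤m+n g g)))) (conv-initial x y _ _ i i<j)
        shifted : ∀ i → j + i < g + g → p (j + i) ≡ q i
        shifted i j+i<2g = trans (p-conv (j + i) j+i<2g) (conv-shift x y _ _ i)
        final : ∀ i → e ≤ i → i < e + j → q i ≡ true
        final i e≤i i<e+j = trans (sym (shifted i j+i<2g)) (full (j + i) (≤-trans (≤-reflexive (sym j+e)) (+-monoʳ-≤ j e≤i))
          (≤-trans j+i<2g (+-monoʳ-≤ g (<⇒≤ g<b))))
          where
          j+i<2g : j + i < g + g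
          j+i<2g = ≤-trans (+-monoʳ-< j (subst (i <_) (trans (+-comm e j) j+e) i<e+j)) (+-monoˡ-≤ g x+y≤g)

  -- With g + 1 leading zeros the integer g is missing, and `bad` counts it. The words that `word`
  -- does not cover are thus absorbed by the error.
  bad-replicate : ∀ M v B → length (replicate (suc g) false ++ v) ≡ L → length B ≡ L →
                  0 < bad g b (join M (replicate (suc g) false ++ v) B)
  bad-replicate M v B lA lB = n≢0⇒n>0 λ e₀ → contradiction
    (trans (sym (misses≡0⇒ g b (conv S (reverse S)) e₀ g ≤-refl (m<m+n g (≤-trans (s≤s z≤n) g<b))))
      (trans (conv-join M A B g (subst (g <_) (sym lA) (m≤m+n (suc g) h)) (subst (g <_) (sym lB) (m≤m+n (suc g) h)))
             (conv-initial (suc g) 0 v B g (≤-reflexive (sym (+-identityʳ (suc g)))))))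
    λ ()
    where
    A = replicate (suc g) false ++ v
    S = join M A B

  bad-replicate′ : ∀ M v A → length (replicate (suc g) false ++ v) ≡ L → length A ≡ L →
                   0 < bad g b (join M A (replicate (suc g) false ++ v))
  bad-replicate′ M v A lB lA = n≢0⇒n>0 λ e₀ → contradiction
    (trans (sym (misses≡0⇒ g b (conv S (reverse S)) e₀ g ≤-refl (m<m+n g (≤-trans (s≤s z≤n) g<b))))
      (trans (conv-join M A B g (subst (g <_) (sym lA) (m≤m+n (suc g) h)) (subst (g <_) (sym lB) (m≤m+n (suc g) h)))
             (conv-initial 0 (suc g) A v g ≤-refl)))
    λ ()
    where
    B = replicate (suc g) false ++ v
    S = join M A B

-- Weights of the leading zeros

sum<-0 : ∀ n → sum< n (λ _ → 0) ≡ 0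
sum<-0 n = trans (sum<-const n 0) (*-zeroʳ n)

-- For fixed C and D with r missing integers, this counts the choices of x, y, V and W with x + y +
-- r = m. Divided by 4 ^ g, it is a truncated sum of 2 ^ -(x + y).
κ : ℕ → ℕ → ℕ → ℕ
κ g m r = sum< (suc g) (λ x → 2 ^ (g ∸ x) * sum< (suc g) (λ y → 2 ^ (g ∸ y) * 𝟙 (x + y + r ≡ᵇ m)))

κ-suc : ∀ g m r → κ g (suc m) (suc r) ≡ κ g m r
κ-suc g m r = sum<-cong (suc g) λ x _ → cong (2 ^ (g ∸ x) *_) (sum<-cong (suc g) λ y _ →
  cong (λ k → 2 ^ (g ∸ y) * 𝟙 (k ≡ᵇ suc m)) (+-suc (x + y) r))

κ-zero-suc : ∀ g r → κ g 0 (suc r) ≡ 0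
κ-zero-suc g r = trans (sum<-cong (suc g) λ x _ → trans (cong (2 ^ (g ∸ x) *_) (trans
    (sum<-cong (suc g) λ y _ → trans (cong (λ k → 2 ^ (g ∸ y) * 𝟙 (k ≡ᵇ 0)) (+-suc (x + y) r)) (*-zeroʳ (2 ^ (g ∸ y))))
    (sum<-0 (suc g)))) (*-zeroʳ (2 ^ (g ∸ x)))) (sum<-0 (suc g))

opaque
  unfolding sum<

  sum<-single : ∀ n x j → sum< n (λ y → 𝟙 (x + y + 0 ≡ᵇ j)) ≤ 1
  sum<-single n       (suc x) zero    = ≤-trans (≤-reflexive (sum<-0 n)) z≤n
  sum<-single n       (suc x) (suc j) = sum<-single n x j
  sum<-single zero    zero    j       = z≤n
  sum<-single (suc n) zero    zero    = s≤s (≤-reflexive (sum<-0 n))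
  sum<-single (suc n) zero    (suc j) = sum<-single n zero j

  sum<-diagonal : ∀ n k j → sum< n (λ x → sum< k (λ y → 𝟙 (x + y + 0 ≡ᵇ j))) ≤ suc j
  sum<-diagonal zero    k j       = z≤n
  sum<-diagonal (suc n) k zero    = +-mono-≤ (sum<-single k 0 0)
    (≤-reflexive (trans (sum<-cong n λ _ _ → sum<-0 k) (sum<-0 n)))
  sum<-diagonal (suc n) k (suc j) = +-mono-≤ (sum<-single k 0 (suc j)) (sum<-diagonal n k j)

-- Every term with x + y = j equals 4 ^ g / 2 ^ j, and there are at most j + 1 of them.
2^*κ : ∀ g j → 2 ^ j * κ g j 0 ≤ suc j * 4 ^ g
2^*κ g j = begin
  2 ^ j * κ g j 0
    ≡⟨ sum<-*ˡ (suc g) (2 ^ j) _ ⟨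
  sum< (suc g) (λ x → 2 ^ j * (2 ^ (g ∸ x) * sum< (suc g) (λ y → 2 ^ (g ∸ y) * 𝟙 (x + y + 0 ≡ᵇ j))))
    ≤⟨ sum<-mono (suc g) (λ x x≤g → row x (s≤s⁻¹ x≤g)) ⟩
  sum< (suc g) (λ x → 4 ^ g * sum< (suc g) (λ y → 𝟙 (x + y + 0 ≡ᵇ j)))
    ≡⟨ sum<-*ˡ (suc g) (4 ^ g) _ ⟩
  4 ^ g * sum< (suc g) (λ x → sum< (suc g) (λ y → 𝟙 (x + y + 0 ≡ᵇ j)))
    ≤⟨ *-monoʳ-≤ (4 ^ g) (sum<-diagonal (suc g) (suc g) j) ⟩
  4 ^ g * suc j
    ≡⟨ *-comm (4 ^ g) (suc j) ⟩
  suc j * 4 ^ g ∎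
  where
  open ≤-Reasoning
  2^-split : ∀ x → x ≤ g → 2 ^ x * 2 ^ (g ∸ x) ≡ 2 ^ g
  2^-split x x≤g = trans (sym (^-distribˡ-+-* 2 x (g ∸ x))) (cong (2 ^_) (m+[n∸m]≡n x≤g))
  entry : ∀ x y → x ≤ g → y ≤ g → ∀ c → (c ≡ true → x + y + 0 ≡ j) →
          2 ^ j * (2 ^ (g ∸ x) * (2 ^ (g ∸ y) * 𝟙 c)) ≡ 4 ^ g * 𝟙 c
  entry x y x≤g y≤g false e = trans (cong (λ k → 2 ^ j * (2 ^ (g ∸ x) * k)) (*-zeroʳ (2 ^ (g ∸ y))))
    (trans (cong (2 ^ j *_) (*-zeroʳ (2 ^ (g ∸ x)))) (trans (*-zeroʳ (2 ^ j)) (sym (*-zeroʳ (4 ^ g)))))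
  entry x y x≤g y≤g true  e = trans
    (cong (_* (2 ^ (g ∸ x) * (2 ^ (g ∸ y) * 1)))
      (trans (cong (2 ^_) (trans (sym (e refl)) (+-identityʳ (x + y)))) (^-distribˡ-+-* 2 x y)))
    (trans (shuffle (2 ^ x) (2 ^ y) (2 ^ (g ∸ x)) (2 ^ (g ∸ y)))
      (cong (_* 1) (trans (cong₂ _*_ (2^-split x x≤g) (2^-split y y≤g)) (2^*2^ g))))
    where
    shuffle : ∀ a b c d → a * b * (c * (d * 1)) ≡ (a * c) * (b * d) * 1
    shuffle = solve-∀
  row : ∀ x → x ≤ g → 2 ^ j * (2 ^ (g ∸ x) * sum< (suc g) (λ y → 2 ^ (g ∸ y) * 𝟙 (x + y + 0 ≡ᵇ j))) ≤
                      4 ^ g * sum< (suc g) (λ y → 𝟙 (x + y + 0 ≡ᵇ j))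
  row x x≤g = ≤-reflexive (trans
    (cong (2 ^ j *_) (sym (sum<-*ˡ (suc g) (2 ^ (g ∸ x)) _)))
    (trans (sym (sum<-*ˡ (suc g) (2 ^ j) _))
      (trans (sum<-cong (suc g) λ y y≤g → entry x y x≤g (s≤s⁻¹ y≤g) (x + y + 0 ≡ᵇ j)
                λ e → ≡ᵇ⇒≡ (x + y + 0) j (subst T (sym e) _))
        (sum<-*ˡ (suc g) (4 ^ g) _))))

-- The values of `coef₀` at 0, 1, 2 are exactly 4 (j + 1) / 2 ^ j. From j = 3 on that expression is
-- at most 2, which amounts to 4 + i ≤ 4 · 2 ^ i for j = 3 + i.
κ≤coef : ∀ g m r → 4 * κ g m r ≤ 4 ^ g * coef m r
κ≤coef g zero    (suc r) = ≤-trans (≤-reflexive (cong (4 *_) (κ-zero-suc g r))) z≤n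
κ≤coef g (suc m) (suc r) = ≤-trans (≤-reflexive (cong (4 *_) (κ-suc g m r))) (κ≤coef g m r)
κ≤coef g 0 zero = ≤-trans (*-monoʳ-≤ 4 (≤-trans (≤-reflexive (sym (+-identityʳ _))) (2^*κ g 0))) (≤-reflexive (lemma (4 ^ g)))
  where
  lemma : ∀ p → 4 * (p + 0) ≡ p * 4
  lemma = solve-∀
κ≤coef g 1 zero = ≤-trans (≤-reflexive (lemma (κ g 1 0))) (≤-trans (*-monoʳ-≤ 2 (2^*κ g 1)) (≤-reflexive (lemma′ (4 ^ g))))
  where
  lemma : ∀ k → 4 * k ≡ 2 * (2 * k)
  lemma = solve-∀
  lemma′ : ∀ p → 2 * (2 * p) ≡ p * 4
  lemma′ = solve-∀
κ≤coef g 2 zero = ≤-trans (2^*κ g 2) (≤-reflexive (*-comm 3 (4 ^ g)))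
κ≤coef g (suc (suc (suc j))) zero = *-cancelˡ-≤ (2 ^ suc j) {{m^n≢0 2 (suc j)}} (begin
  2 ^ suc j * (4 * κ g (3 + j) 0)       ≡⟨ lemma (2 ^ j) (κ g (3 + j) 0) ⟩
  2 ^ (3 + j) * κ g (3 + j) 0           ≤⟨ 2^*κ g (3 + j) ⟩
  (4 + j) * 4 ^ g                       ≤⟨ *-monoˡ-≤ (4 ^ g) (4+j≤ j) ⟩
  4 * 2 ^ j * 4 ^ g                     ≡⟨ lemma′ (2 ^ j) (4 ^ g) ⟩
  2 ^ suc j * (4 ^ g * 2)               ∎)
  where
  open ≤-Reasoning
  lemma : ∀ p k → 2 * p * (4 * k) ≡ 2 * (2 * (2 * p)) * k
  lemma = solve-∀
  lemma′ : ∀ p q → 4 * p * q ≡ 2 * p * (q * 2)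
  lemma′ = solve-∀
  4+j≤ : ∀ j → 4 + j ≤ 4 * 2 ^ j
  4+j≤ zero    = ≤-refl
  4+j≤ (suc j) = ≤-trans (s≤s (4+j≤ j)) (≤-trans (+-monoˡ-≤ (4 * 2 ^ j) (≤-trans (m^n>0 2 j) (m≤n*m (2 ^ j) 4)))
    (≤-reflexive (double (2 ^ j))))
    where
    double : ∀ p → 4 * p + 4 * p ≡ 4 * (2 * p)
    double = solve-∀

-- As g = 2 + l ≥ 2, the truncation removes no point with x + y = 2 - r. `term` picks the point y =
-- 2 - r - x in row x, and the rows 0, 1, 2 contain them all.
coef₂≤κ : ∀ l r → 4 ^ (2 + l) * coef 2 r ≤ 4 * κ (2 + l) 2 r
coef₂≤κ l r = ≤-trans (by-cases r) (*-monoʳ-≤ 4 (first-three (row r)))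
  where
  open ≤-Reasoning
  term row : ℕ → ℕ → ℕ
  row r x = 2 ^ (2 + l ∸ x) * sum< (3 + l) (λ y → 2 ^ (2 + l ∸ y) * 𝟙 (x + y + r ≡ᵇ 2))
  term r x = 2 ^ (2 + l ∸ x) * (2 ^ (2 + l ∸ (2 ∸ r ∸ x)) * 𝟙 (x + (2 ∸ r ∸ x) + r ≡ᵇ 2))
  term≤row : ∀ r x → term r x ≤ row r x
  term≤row r x = *-monoʳ-≤ (2 ^ (2 + l ∸ x)) (entry≤sum< (2 ∸ r ∸ x) (λ y → 2 ^ (2 + l ∸ y) * 𝟙 (x + y + r ≡ᵇ 2))
    (s≤s (≤-trans (m∸n≤m (2 ∸ r) x) (≤-trans (m∸n≤m 2 r) (m≤m+n 2 l)))))
  first-three : ∀ f → f 0 + (f 1 + f 2) ≤ sum< (3 + l) f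
  first-three f = begin
    f 0 + (f 1 + f 2)                          ≤⟨ +-monoʳ-≤ (f 0) (+-monoʳ-≤ (f 1) (entry≤sum< 0 (λ j → f (2 + j)) z<s)) ⟩
    f 0 + (f 1 + sum< (1 + l) (λ j → f (2 + j))) ≡⟨ cong (f 0 +_) (sum<-suc (1 + l) (f ∘ suc)) ⟨
    f 0 + sum< (2 + l) (f ∘ suc)               ≡⟨ sum<-suc (2 + l) f ⟨
    sum< (3 + l) f                             ∎
  4^ : 4 ^ (2 + l) ≡ 4 * (4 * (2 ^ l * 2 ^ l))
  4^ = cong (λ p → 4 * (4 * p)) (sym (2^*2^ l))
  lemma₀ : ∀ p → 4 * (4 * (p * p)) * 3 ≡
    4 * (2 * (2 * p) * (p * 1) + (2 * p * (2 * p * 1) + p * (2 * (2 * p) * 1)))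
  lemma₀ = solve-∀
  lemma₁ : ∀ p → 4 * (4 * (p * p)) * 4 ≡ 4 * (2 * (2 * p) * (2 * p * 1) + (2 * p * (2 * (2 * p) * 1) + 0))
  lemma₁ = solve-∀
  lemma₂ : ∀ p → 4 * (4 * (p * p)) * 4 ≡ 4 * (2 * (2 * p) * (2 * (2 * p) * 1) + (0 + 0))
  lemma₂ = solve-∀
  by-cases : ∀ r → 4 ^ (2 + l) * coef 2 r ≤ 4 * (row r 0 + (row r 1 + row r 2))
  by-cases 0 = ≤-trans (≤-reflexive (trans (cong (_* 3) 4^) (lemma₀ (2 ^ l))))
    (*-monoʳ-≤ 4 (+-mono-≤ (term≤row 0 0) (+-mono-≤ (term≤row 0 1) (term≤row 0 2))))
  by-cases 1 = ≤-trans (≤-reflexive (trans (cong (_* 4) 4^) (lemma₁ (2 ^ l))))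
    (*-monoʳ-≤ 4 (+-mono-≤ (term≤row 1 0) (+-mono-≤ (term≤row 1 1) z≤n)))
  by-cases 2 = ≤-trans (≤-reflexive (trans (cong (_* 4) 4^) (lemma₂ (2 ^ l))))
    (*-monoʳ-≤ 4 (+-mono-≤ (term≤row 2 0) z≤n))
  by-cases (suc (suc (suc r))) = ≤-trans (≤-reflexive (*-zeroʳ (4 ^ (2 + l)))) z≤n

-- Counting subsets by the number of missing positive differences

∑∑-exchange : ∀ h k (w : ℕ → ℕ) (φ : ℕ → ℕ → List Bool → List Bool → ℕ) →
  sum< k (λ x → w x * ∑ h (λ C → sum< k (λ y → w y * ∑ h (φ x y C)))) ≡
  ∑∑ h (λ C D → sum< k (λ x → w x * sum< k (λ y → w y * φ x y C D)))
∑∑-exchange h k w φ = sym (trans (∑∑-sum< h k _) (sum<-cong k λ x _ → trans (∑∑-*ˡ h (w x) _)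
  (cong (w x *_) (∑-cong h λ C _ → trans (∑-sum< h k _) (sum<-cong k λ y _ → ∑-*ˡ h (w y) (φ x y C))))))

∑∑-κ : ∀ h g m (N : List Bool → List Bool → ℕ) →
  sum< (suc g) (λ x → 2 ^ (g ∸ x) * ∑ h (λ C → sum< (suc g) (λ y → 2 ^ (g ∸ y) * ∑ h (λ D → 𝟙 (x + y + N C D ≡ᵇ m))))) ≡
  ∑∑ h (λ C D → κ g m (N C D))
∑∑-κ h g m N = ∑∑-exchange h (suc g) (λ x → 2 ^ (g ∸ x)) (λ x y C D → 𝟙 (x + y + N C D ≡ᵇ m))

-- Without truncated subtraction, this is 4 d (o′ - o) ≥ 4 d P (k′ - k) - 8 d B ≥ d P Q (x′ - x) - 8
-- d B ≥ P Q (W - 8 d β) > 0.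
less-by-gap : ∀ d P Q W β B o o′ k k′ x x′ .{{_ : NonZero d}} .{{_ : NonZero (P * Q)}} →
  o ≤ P * k + B → P * k′ ≤ o′ + B → 4 * k ≤ Q * x → Q * x′ ≤ 4 * k′ →
  d * x + W ≤ d * x′ → B ≤ β * (P * Q) → 8 * (d * β) < W → o < o′
less-by-gap d P Q W β B o o′ k k′ x x′ o≤ ≤o′ k≤ ≤k′ gap B≤ small =
  *-cancelˡ-< (4 * d) o o′ (+-cancelʳ-< (8 * (d * B)) (4 * d * o) (4 * d * o′) (begin-strict
    4 * d * o + 8 * (d * B)
      ≤⟨ +-mono-≤ (*-monoʳ-≤ (4 * d) o≤) (*-monoʳ-≤ 8 (*-monoʳ-≤ d B≤)) ⟩
    4 * d * (P * k + B) + 8 * (d * (β * (P * Q)))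
      ≡⟨ regroup d P k B β Q ⟩
    d * (P * (4 * k)) + 8 * (d * β) * (P * Q) + 4 * d * B
      <⟨ +-monoˡ-< (4 * d * B) (+-mono-≤-< (*-monoʳ-≤ d (*-monoʳ-≤ P k≤)) (*-monoˡ-< (P * Q) small)) ⟩
    d * (P * (Q * x)) + W * (P * Q) + 4 * d * B
      ≡⟨ factor d P Q x W B ⟩
    P * (Q * (d * x + W)) + 4 * d * B
      ≤⟨ +-monoˡ-≤ (4 * d * B) (*-monoʳ-≤ P (*-monoʳ-≤ Q gap)) ⟩
    P * (Q * (d * x′)) + 4 * d * B
      ≡⟨ swap d P Q x′ B ⟩
    P * (d * (Q * x′)) + 4 * d * B
      ≤⟨ +-monoˡ-≤ (4 * d * B) (*-monoʳ-≤ P (*-monoʳ-≤ d ≤k′)) ⟩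
    P * (d * (4 * k′)) + 4 * d * B
      ≡⟨ regroup′ d P k′ B ⟩
    4 * d * (P * k′) + 4 * d * B
      ≤⟨ +-monoˡ-≤ (4 * d * B) (*-monoʳ-≤ (4 * d) ≤o′) ⟩
    4 * d * (o′ + B) + 4 * d * B
      ≡⟨ regroup″ d o′ B ⟩
    4 * d * o′ + 8 * (d * B) ∎))
  where
  open ≤-Reasoning
  regroup : ∀ d P k B β Q → 4 * d * (P * k + B) + 8 * (d * (β * (P * Q))) ≡ d * (P * (4 * k)) + 8 * (d * β) * (P * Q) + 4 * d * B
  regroup = solve-∀
  factor : ∀ d P Q x W B → d * (P * (Q * x)) + W * (P * Q) + 4 * d * B ≡ P * (Q * (d * x + W)) + 4 * d * B
  factor = solve-∀
  swap : ∀ d P Q x B → P * (Q * (d * x)) + 4 * d * B ≡ P * (d * (Q * x)) + 4 * d * B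
  swap = solve-∀
  regroup′ : ∀ d P k B → P * (d * (4 * k)) + 4 * d * B ≡ 4 * d * (P * k) + 4 * d * B
  regroup′ = solve-∀
  regroup″ : ∀ d o B → 4 * d * (o + B) + 4 * d * B ≡ 4 * d * o + 8 * (d * B)
  regroup″ = solve-∀

module Count (h ρ : ℕ) where
  open Fringe h ρ public

  occurrences : ℕ → ℕ
  occurrences m = ∑ n (λ S → 𝟙 (μ S ≡ᵇ m))

  B : ℕ
  B = ∑ n (bad g b)

  ∑-join : ∀ F → ∑ n F ≡ ∑ ρ (λ M → ∑∑ L (λ A B → F (join M A B)))
  ∑-join F = begin
    ∑ n F
      ≡⟨ cong (λ n → ∑ n F) n≡ ⟩
    ∑ (L + (ρ + L)) F
      ≡⟨ ∑-++ L (ρ + L) F ⟩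
    ∑ L (λ A → ∑ (ρ + L) (λ R → F (A ++ R)))
      ≡⟨ (∑-cong L λ A _ → trans (∑-++ ρ L _) (∑-cong ρ λ M _ → sym (∑-reverse L _))) ⟩
    ∑ L (λ A → ∑ ρ (λ M → ∑ L (λ B → F (join M A B))))
      ≡⟨ ∑-swap L ρ _ ⟩
    ∑ ρ (λ M → ∑∑ L (λ A B → F (join M A B))) ∎
    where open ≡-Reasoning

  K : ℕ → ℕ
  K m = ∑∑ h (λ C D → κ g m (ν h C D))

  -- A bad S has e ≥ 1, which pays for any disagreement. Since `bad` counts missing integers rather
  -- than flagging their existence, its sum is the union bound itself.
  unless-bad : ∀ {c d e} → (e ≡ 0 → c ≡ d) → 𝟙 c ≤ 𝟙 d + e
  unless-bad {c} {d} {zero}  c≡d = ≤-reflexive (trans (cong 𝟙 (c≡d refl)) (sym (+-identityʳ (𝟙 d))))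
  unless-bad {c} {d} {suc e} c≡d = ≤-trans (𝟙≤1 c) (≤-trans (s≤s z≤n) (m≤n+m (suc e) (𝟙 d)))

  occurrences≤ : ∀ m → occurrences m ≤ 2 ^ ρ * K m + B
  occurrences≤ m = begin
    occurrences m
      ≡⟨ ∑-join _ ⟩
    ∑ ρ (λ M → ∑∑ L (λ A B → occ M A B))
      ≤⟨ (∑-mono ρ λ M _ → subst (λ s → ∑∑ L (occ M) ≤ s + ∑∑ L (bd M)) (∑∑-κ h g m (ν h))
           (∑-word-≤ (suc g) h _ _ (λ A → ∑ L (bd M A)) (outer M) (outer-rest M))) ⟩
    ∑ ρ (λ M → K m + ∑∑ L (bd M))
      ≡⟨ trans (∑-+ ρ _ _) (cong₂ _+_ (∑-const ρ (K m)) (sym (∑-join (bad g b)))) ⟩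
    2 ^ ρ * K m + B ∎
    where
    open ≤-Reasoning
    occ bd : List Bool → List Bool → List Bool → ℕ
    occ M A B = 𝟙 (μ (join M A B) ≡ᵇ m)
    bd M A B = bad g b (join M A B)
    outer : ∀ M x C V → x < suc g → length C ≡ h → length V ≡ g ∸ x →
      ∑ L (occ M (word x C V)) ≤
      sum< (suc g) (λ y → 2 ^ (g ∸ y) * ∑ h (λ D → 𝟙 (x + y + ν h C D ≡ᵇ m))) + ∑ L (bd M (word x C V))
    outer M x C V x≤g lC lV = ∑-word-≤ (suc g) h _ _ _
      (λ y D W y≤g lD lW → unless-bad λ e₀ → cong (_≡ᵇ m) (μ-word M x C V x≤g lC lV y D W y≤g lD lW e₀))
      (λ v lv → ≤-trans (𝟙≤1 _) (bad-replicate′ M v (word x C V) (length-rest v lv) (length-L x C V x≤g lC lV)))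
      where
      length-rest : ∀ v → length v ≡ h → length (replicate (suc g) false ++ v) ≡ L
      length-rest v lv = trans (length-++ (replicate (suc g) false)) (cong₂ _+_ (length-replicate (suc g)) lv)
      length-L : ∀ x C V → x < suc g → length C ≡ h → length V ≡ g ∸ x → length (word x C V) ≡ L
      length-L x C V x≤g lC lV = trans (length-word x C V x≤g lC lV) (cong suc (+-suc h h))
    outer-rest : ∀ M v → length v ≡ h →
      ∑ L (occ M (replicate (suc g) false ++ v)) ≤ ∑ L (bd M (replicate (suc g) false ++ v))
    outer-rest M v lv = ∑-mono L λ B lB → ≤-trans (𝟙≤1 _)
      (bad-replicate M v B (trans (length-++ (replicate (suc g) false)) (cong₂ _+_ (length-replicate (suc g)) lv)) lB)

  K≤occurrences : ∀ m → 2 ^ ρ * K m ≤ occurrences m + B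
  K≤occurrences m = begin
    2 ^ ρ * K m
      ≡⟨ ∑-const ρ (K m) ⟨
    ∑ ρ (λ _ → K m)
      ≤⟨ (∑-mono ρ λ M _ → subst (_≤ ∑∑ L (H M)) (∑∑-κ h g m (ν h)) (∑-word-≥ (suc g) h _ _ (λ x C V x≤g lC lV →
            ∑-word-≥ (suc g) h _ _ (λ y D W y≤g lD lW → unless-bad λ e₀ →
              cong (_≡ᵇ m) (sym (μ-word M x C V x≤g lC lV y D W y≤g lD lW e₀)))))) ⟩
    ∑ ρ (λ M → ∑∑ L (H M))
      ≡⟨ ∑-join _ ⟨
    ∑ n (λ S → 𝟙 (μ S ≡ᵇ m) + bad g b S)
      ≡⟨ ∑-+ n _ _ ⟩
    occurrences m + B ∎
    where
    open ≤-Reasoning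
    H : List Bool → List Bool → List Bool → ℕ
    H M A B = 𝟙 (μ (join M A B) ≡ᵇ m) + bad g b (join M A B)

  B≤ : B ≤ b * 3 ^ g * (2 ^ ρ * 4 ^ g)
  B≤ = *-cancelˡ-≤ (4 ^ g) {{m^n≢0 4 g}} (begin
    4 ^ g * B
      ≤⟨ ∑-bad g b (≤-trans (≤-reflexive (cong₂ _+_ 2g≡L 2g≡L)) (≤-trans (+-monoʳ-≤ L (m≤n+m L ρ)) (≤-reflexive (sym n≡)))) ⟩
    b * (3 ^ g * 2 ^ n)
      ≡⟨ cong (λ p → b * (3 ^ g * p)) 2^n ⟩
    b * (3 ^ g * (4 ^ g * (2 ^ ρ * 4 ^ g)))
      ≡⟨ lemma b (3 ^ g) (4 ^ g) (2 ^ ρ) ⟩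
    4 ^ g * (b * 3 ^ g * (2 ^ ρ * 4 ^ g)) ∎)
    where
    open ≤-Reasoning
    2g≡L : g + g ≡ L
    2g≡L = cong suc (+-suc h h)
    2^L : 2 ^ L ≡ 4 ^ g
    2^L = trans (cong (2 ^_) (sym 2g≡L)) (trans (^-distribˡ-+-* 2 g g) (2^*2^ g))
    2^n : 2 ^ n ≡ 4 ^ g * (2 ^ ρ * 4 ^ g)
    2^n = trans (cong (2 ^_) n≡) (trans (^-distribˡ-+-* 2 L (ρ + L)) (cong₂ _*_ 2^L (trans (^-distribˡ-+-* 2 ρ L) (cong (2 ^ ρ *_) 2^L))))
    lemma : ∀ b t q r → b * (t * (q * (r * q))) ≡ q * (b * t * (r * q))
    lemma = solve-∀

  occurrences-< : 16 ≤ h → 8 * (2 ^ 12 * (b * 3 ^ g)) < 4 ^ h → ∀ m → m ≢ 2 → occurrences m < occurrences 2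
  occurrences-< 16≤h small m m≢2 = less-by-gap (2 ^ 12) (2 ^ ρ) (4 ^ g) (4 ^ h) (b * 3 ^ g) B
    (occurrences m) (occurrences 2) (K m) (K 2) (X m) (X 2)
    {{m^n≢0 2 12}} {{m*n≢0 (2 ^ ρ) (4 ^ g) {{m^n≢0 2 ρ}} {{m^n≢0 4 g}}}}
    (occurrences≤ m) (K≤occurrences 2) upper lower (coef-gap h 16≤h m m≢2) B≤ small
    where
    X : ℕ → ℕ
    X m = ∑∑ h (λ C D → coef m (ν h C D))
    upper : 4 * K m ≤ 4 ^ g * X m
    upper = ≤-trans (≤-reflexive (sym (∑∑-*ˡ h 4 _)))
      (≤-trans (∑∑-mono h λ C D _ _ → κ≤coef g m (ν h C D)) (≤-reflexive (∑∑-*ˡ h (4 ^ g) _)))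
    coef₂≤κ′ : ∀ r → 4 ^ g * coef 2 r ≤ 4 * κ g 2 r
    coef₂≤κ′ = subst (λ h → ∀ r → 4 ^ suc h * coef 2 r ≤ 4 * κ (suc h) 2 r)
      (m+[n∸m]≡n {1} (≤-trans (s≤s z≤n) 16≤h)) (coef₂≤κ (h ∸ 1))
    lower : 4 ^ g * X 2 ≤ 4 * K 2
    lower = ≤-trans (≤-reflexive (sym (∑∑-*ˡ h (4 ^ g) _)))
      (≤-trans (∑∑-mono h λ C D _ _ → coef₂≤κ′ (ν h C D)) (≤-reflexive (∑∑-*ˡ h 4 _)))

-- Passing from g to g + 1 multiplies the left side by 3 (g + 1) / g, which is at most 4 for g ≥ 3;
-- hence the form 3 + k₀ of the starting point.
linear*3^<4^ : ∀ d k₀ → d * ((3 + k₀) * 3 ^ (3 + k₀)) < 4 ^ (3 + k₀) →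
               ∀ g → 3 + k₀ ≤ g → d * (g * 3 ^ g) < 4 ^ g
linear*3^<4^ d k₀ base g k₀≤g = subst (λ g → d * (g * 3 ^ g) < 4 ^ g) (m+[n∸m]≡n k₀≤g) (go (g ∸ (3 + k₀)))
  where
  open ≤-Reasoning
  regroup : ∀ d g t → d * (g * (3 * t)) ≡ 3 * g * (d * t)
  regroup = solve-∀
  regroup′ : ∀ d g t → 4 * g * (d * t) ≡ 4 * (d * (g * t))
  regroup′ = solve-∀
  expand : ∀ k₀ k → 3 * suc (3 + k₀ + k) + (k₀ + k) ≡ 4 * (3 + k₀ + k)
  expand = solve-∀
  go : ∀ k → d * ((3 + k₀ + k) * 3 ^ (3 + k₀ + k)) < 4 ^ (3 + k₀ + k)
  go zero    = subst (λ g → d * (g * 3 ^ g) < 4 ^ g) (sym (+-identityʳ (3 + k₀))) base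
  go (suc k) = subst (λ g → d * (g * 3 ^ g) < 4 ^ g) (sym (+-suc (3 + k₀) k)) (begin-strict
    d * (suc (3 + k₀ + k) * 3 ^ suc (3 + k₀ + k))
      ≡⟨ regroup d (suc (3 + k₀ + k)) (3 ^ (3 + k₀ + k)) ⟩
    3 * suc (3 + k₀ + k) * (d * 3 ^ (3 + k₀ + k))
      ≤⟨ *-monoˡ-≤ (d * 3 ^ (3 + k₀ + k)) (≤-trans (m≤m+n (3 * suc (3 + k₀ + k)) (k₀ + k)) (≤-reflexive (expand k₀ k))) ⟩
    4 * (3 + k₀ + k) * (d * 3 ^ (3 + k₀ + k))
      ≡⟨ regroup′ d (3 + k₀ + k) (3 ^ (3 + k₀ + k)) ⟩
    4 * (d * ((3 + k₀ + k) * 3 ^ (3 + k₀ + k)))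
      <⟨ *-monoʳ-< 4 (go k) ⟩
    4 ^ suc (3 + k₀ + k) ∎)

-- From words to the definition of missing

count-suc : ∀ n {P : Subset (suc n) → Set} (P? : ∀ S → Dec (P S)) →
  length (filter P? (allSubsets (suc n))) ≡
  length (filter (P? ∘ (true ∷_)) (allSubsets n)) + length (filter (P? ∘ (false ∷_)) (allSubsets n))
count-suc n P? = trans (cong length (filter-++ P? (map (true ∷_) (allSubsets n)) _))
  (trans (length-++ (filter P? (map (true ∷_) (allSubsets n)))) (cong₂ _+_ (on-map (true ∷_) (allSubsets n)) (on-map (false ∷_) (allSubsets n))))
  where
  on-map : ∀ (f : Subset n → Subset (suc n)) xs → length (filter P? (map f xs)) ≡ length (filter (P? ∘ f) xs)
  on-map f []       = refl
  on-map f (x ∷ xs) with P? (f x)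
  ... | yes _ = cong suc (on-map f xs)
  ... | no  _ = on-map f xs

count-≤-∑ : ∀ n {P : Subset n → Set} (P? : ∀ S → Dec (P S)) (φ : List Bool → Bool) →
  (∀ S → P S → φ (toList S) ≡ true) → length (filter P? (allSubsets n)) ≤ ∑ n (𝟙 ∘ φ)
count-≤-∑ zero    P? φ h = ≤-trans (base (P? [])) (≤-reflexive (sym (∑-zero (𝟙 ∘ φ))))
  where
  base : Dec _ → length (filter P? ([] ∷ [])) ≤ 𝟙 (φ [])
  base _ with P? []
  ... | yes p = ≤-reflexive (cong 𝟙 (sym (h [] p)))
  ... | no  _ = z≤n
count-≤-∑ (suc n) P? φ h = ≤-trans (≤-reflexive (count-suc n P?))
  (≤-trans (+-mono-≤ (count-≤-∑ n (P? ∘ (true ∷_)) (φ ∘ (true ∷_)) (h ∘ (true ∷_)))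
                     (count-≤-∑ n (P? ∘ (false ∷_)) (φ ∘ (false ∷_)) (h ∘ (false ∷_))))
           (≤-reflexive (sym (∑-suc n (𝟙 ∘ φ)))))

∑-≤-count : ∀ n {P : Subset n → Set} (P? : ∀ S → Dec (P S)) (φ : List Bool → Bool) →
  (∀ S → φ (toList S) ≡ true → P S) → ∑ n (𝟙 ∘ φ) ≤ length (filter P? (allSubsets n))
∑-≤-count zero    P? φ h = ≤-trans (≤-reflexive (∑-zero (𝟙 ∘ φ))) (base (φ []) refl)
  where
  base : ∀ b → φ [] ≡ b → 𝟙 b ≤ length (filter P? ([] ∷ []))
  base false _ = z≤n
  base true  e with P? []
  ... | yes _ = ≤-refl
  ... | no ¬p = contradiction (h [] e) ¬p
∑-≤-count (suc n) P? φ h = ≤-trans (≤-reflexive (∑-suc n (𝟙 ∘ φ)))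
  (≤-trans (+-mono-≤ (∑-≤-count n (P? ∘ (true ∷_)) (φ ∘ (true ∷_)) (h ∘ (true ∷_)))
                     (∑-≤-count n (P? ∘ (false ∷_)) (φ ∘ (false ∷_)) (h ∘ (false ∷_))))
           (≤-reflexive (sym (count-suc n P?))))

sum<-∷ʳ : ∀ n f → sum< (suc n) f ≡ sum< n f + f n
sum<-∷ʳ zero    f = trans (sum<-suc 0 f) (trans (cong (f 0 +_) (sum<-zero _)) (trans (+-comm (f 0) 0) (cong (_+ f 0) (sym (sum<-zero f)))))
sum<-∷ʳ (suc n) f = trans (sum<-suc (suc n) f) (trans (cong (f 0 +_) (sum<-∷ʳ n (f ∘ suc)))
  (trans (sym (+-assoc (f 0) _ _)) (cong (_+ f (suc n)) (sym (sum<-suc n f)))))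

sum<-reverse : ∀ n (f : ℕ → ℕ) → sum< n (λ j → f (n ∸ j)) ≡ sum< n (f ∘ suc)
sum<-reverse zero    f = trans (sum<-zero _) (sym (sum<-zero _))
sum<-reverse (suc n) f = begin
  sum< (suc n) (λ j → f (suc n ∸ j))        ≡⟨ sum<-suc n _ ⟩
  f (suc n) + sum< n (λ j → f (n ∸ j))      ≡⟨ cong (f (suc n) +_) (sum<-reverse n f) ⟩
  f (suc n) + sum< n (f ∘ suc)              ≡⟨ +-comm (f (suc n)) _ ⟩
  sum< n (f ∘ suc) + f (suc n)              ≡⟨ sum<-∷ʳ n (f ∘ suc) ⟨
  sum< (suc n) (f ∘ suc)                    ∎
  where open ≡-Reasoning

missing⁺ : List Bool → ℕ → ℕ
missing⁺ S N = misses 0 N (conv S (reverse S))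

missing⁺-differs : ∀ S N → length S ≡ suc N → missing⁺ S N ≡ sum< N (λ i → 𝟙 (not (differs (suc i) S)))
missing⁺-differs S N l = trans (misses-sum< 0 N (conv S (reverse S)))
  (trans (sum<-cong N λ j j<N → cong (𝟙 ∘ not) (differs⇔conv S (N ∸ j) j l (m+[n∸m]≡n (<⇒≤ j<N))))
         (sum<-reverse N (λ d → 𝟙 (not (differs d S)))))

length-filter-applyUpTo : ∀ (p : ℕ → Bool) (f : ℕ → ℕ) r →
  length (filter (λ i → p i ≟ᵇ true) (applyUpTo f r)) + sum< r (λ j → 𝟙 (not (p (f j)))) ≡ r
length-filter-applyUpTo p f zero    = sum<-zero _
length-filter-applyUpTo p f (suc r) = trans (cong (length (filter (λ i → p i ≟ᵇ true) (applyUpTo f (suc r))) +_) (sum<-suc r _)) (step (p (f 0)) refl)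
  where
  rest = sum< r (λ j → 𝟙 (not (p (f (suc j)))))
  tl-length = length (filter (λ i → p i ≟ᵇ true) (applyUpTo (f ∘ suc) r))
  step : ∀ b → p (f 0) ≡ b → length (filter (λ i → p i ≟ᵇ true) (applyUpTo f (suc r))) + (𝟙 (not (p (f 0))) + rest) ≡ suc r
  step true  e rewrite e = cong suc (length-filter-applyUpTo p (f ∘ suc) r)
  step false e rewrite e = trans (+-suc tl-length rest) (cong suc (length-filter-applyUpTo p (f ∘ suc) r))

∈⇒at : ∀ {n} (S : Subset n) x → x Subset.∈ S → at (toList S) (toℕ x) ≡ true
∈⇒at (b ∷ S) zero    here      = refl
∈⇒at (b ∷ S) (suc x) (there p) = ∈⇒at S x p

at⇒∈ : ∀ {n} (S : Subset n) x → at (toList S) (toℕ x) ≡ true → x Subset.∈ S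
at⇒∈ (true ∷ S) zero    refl = here
at⇒∈ (b ∷ S)    (suc x) e    = there (at⇒∈ S x e)

∈-elems⁻ : ∀ {n} (S : Subset n) {k} → k ∈ elems S → ∃[ x ] (k ≡ pos x × at (toList S) x ≡ true)
∈-elems⁻ {n} S k∈ = let i , i∈ , e = ∈-map⁻ (λ i → pos (toℕ i)) k∈
                        _ , i∈S = ∈-filter⁻ (_∈? S) {xs = allFin n} i∈
                    in toℕ i , e , ∈⇒at S i i∈S

∈-elems⁺ : ∀ {n} (S : Subset n) x → at (toList S) x ≡ true → pos x ∈ elems S
∈-elems⁺ {n} S x e = subst (λ k → pos k ∈ elems S) (toℕ-fromℕ< x<n)
  (∈-map⁺ (λ i → pos (toℕ i)) (∈-filter⁺ (_∈? S) (∈-allFin i) (at⇒∈ S i (trans (cong (at (toList S)) (toℕ-fromℕ< x<n)) e))))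
  where
  x<n : x < n
  x<n = subst (x <_) (length-toList S) (at⇒< (toList S) x e)
  i = fromℕ< x<n

∈-diffSet⁺ : ∀ {n} (S : Subset n) x y → at (toList S) x ≡ true → at (toList S) y ≡ true → pos x ℤ.- pos y ∈ diffSet S
∈-diffSet⁺ S x y ex ey = ∈-deduplicate⁺ ℤ._≟_ (∈-cartesianProductWith⁺ ℤ._-_ (∈-elems⁺ S x ex) (∈-elems⁺ S y ey))

∈-diffSet⁻ : ∀ {n} (S : Subset n) {k} → k ∈ diffSet S →
  ∃[ x ] ∃[ y ] (k ≡ pos x ℤ.- pos y × at (toList S) x ≡ true × at (toList S) y ≡ true)
∈-diffSet⁻ S k∈ =
  let a , b , a∈ , b∈ , e = ∈-cartesianProductWith⁻ ℤ._-_ (elems S) (elems S)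
                              (∈-deduplicate⁻ ℤ._≟_ (cartesianProductWith ℤ._-_ (elems S) (elems S)) k∈)
      x , ea , ex = ∈-elems⁻ S a∈
      y , eb , ey = ∈-elems⁻ S b∈
  in x , y , trans e (cong₂ ℤ._-_ ea eb) , ex , ey

positive-difference : ∀ x k → pos (x + k) ℤ.- pos x ≡ pos k
positive-difference x k = trans (ℤ.m-n≡m⊖n (x + k) x) (trans (ℤ.⊖-≥ (m≤m+n x k)) (cong pos (m+n∸m≡n x k)))

negative-difference : ∀ x k → pos x ℤ.- pos (x + suc k) ≡ -[1+ k ]
negative-difference x k = trans (ℤ.m-n≡m⊖n x (x + suc k))
  (trans (ℤ.⊖-< (m<m+n x z<s)) (cong (λ i → ℤ.- (pos i)) (m+n∸m≡n x (suc k))))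

module _ {N : ℕ} (S : Subset (suc N)) where

  private
    W : List Bool
    W = toList S
    lW : length W ≡ suc N
    lW = length-toList S

  present : List ℕ
  present = filter (λ i → differs (suc i) W ≟ᵇ true) (upTo N)

  -- An explicit enumeration of S - S for nonempty S. Being duplicate-free with the same members as
  -- `diffSet S`, it is a permutation of that list and has the same length.
  differences : List ℤ
  differences = pos 0 ∷ (map (pos ∘ suc) present ++ map -[1+_] present)

  ∈-present : ∀ x i → at W x ≡ true → at W (x + suc i) ≡ true → i ∈ present
  ∈-present x i ex ey = ∈-filter⁺ (λ i → differs (suc i) W ≟ᵇ true)
    (∈-upTo⁺ (s≤s⁻¹ (subst (suc i <_) lW (≤-<-trans (m≤n+m (suc i) x) (at⇒< W (x + suc i) ey)))))
    (differs⁺ (suc i) W x ex ey)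

  present⁻ : ∀ {i} → i ∈ present → ∃[ x ] (at W x ≡ true × at W (x + suc i) ≡ true)
  present⁻ {i} i∈ = differs⁻ (suc i) W (proj₂ (∈-filter⁻ (λ i → differs (suc i) W ≟ᵇ true) {xs = upTo N} i∈))

  differences-unique : Unique differences
  differences-unique = tabulate zero∉ ∷ Unique.++⁺ (Unique.map⁺ (λ { refl → refl }) present-unique)
    (Unique.map⁺ (λ { refl → refl }) present-unique) disjoint
    where
    present-unique : Unique present
    present-unique = Unique.filter⁺ _ (Unique.upTo⁺ N)
    disjoint : ∀ {k} → k ∈ map (pos ∘ suc) present × k ∈ map -[1+_] present → _
    disjoint (k∈₁ , k∈₂) with ∈-map⁻ (pos ∘ suc) k∈₁ | ∈-map⁻ -[1+_] k∈₂
    ... | _ , _ , refl | _ , _ , ()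
    zero∉ : ∀ {k} → k ∈ map (pos ∘ suc) present ++ map -[1+_] present → pos 0 ≢ k
    zero∉ k∈ refl with ∈-++⁻ (map (pos ∘ suc) present) k∈
    ... | inj₁ k∈₁ with () ← proj₂ (proj₂ (∈-map⁻ (pos ∘ suc) k∈₁))
    ... | inj₂ k∈₂ with () ← proj₂ (proj₂ (∈-map⁻ -[1+_] k∈₂))

  diffSet⊆differences : ∀ {k} → k ∈ diffSet S → k ∈ differences
  diffSet⊆differences k∈ with ∈-diffSet⁻ S k∈
  ... | x , y , refl , ex , ey with <-cmp x y
  ...   | tri≈ _ refl _ = here (ℤ.+-inverseʳ (pos x))
  ...   | tri< x<y _ _ = there (∈-++⁺ʳ (map (pos ∘ suc) present)
            (subst (_∈ map -[1+_] present) (trans (sym (negative-difference x i)) (cong (λ y → pos x ℤ.- pos y) y≡))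
              (∈-map⁺ -[1+_] (∈-present x i ex (trans (cong (at W) y≡) ey)))))
    where
    i = y ∸ suc x
    y≡ : x + suc i ≡ y
    y≡ = trans (+-suc x i) (m+[n∸m]≡n x<y)
  ...   | tri> _ _ y<x = there (∈-++⁺ˡ
            (subst (_∈ map (pos ∘ suc) present) (trans (sym (positive-difference y (suc i))) (cong (λ x → pos x ℤ.- pos y) x≡))
              (∈-map⁺ (pos ∘ suc) (∈-present y i ey (trans (cong (at W) x≡) ex)))))
    where
    i = x ∸ suc y
    x≡ : y + suc i ≡ x
    x≡ = trans (+-suc y i) (m+[n∸m]≡n y<x)

  differences⊆diffSet : ∀ x → at W x ≡ true → ∀ {k} → k ∈ differences → k ∈ diffSet S
  differences⊆diffSet x ex (here refl) = subst (_∈ diffSet S) (ℤ.+-inverseʳ (pos x)) (∈-diffSet⁺ S x x ex ex)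
  differences⊆diffSet x ex (there k∈) with ∈-++⁻ (map (pos ∘ suc) present) k∈
  ... | inj₁ k∈₁ = let i , i∈ , e = ∈-map⁻ (pos ∘ suc) k∈₁
                       y , e₁ , e₂ = present⁻ i∈
                   in subst (_∈ diffSet S) (trans (positive-difference y (suc i)) (sym e)) (∈-diffSet⁺ S (y + suc i) y e₂ e₁)
  ... | inj₂ k∈₂ = let i , i∈ , e = ∈-map⁻ -[1+_] k∈₂
                       y , e₁ , e₂ = present⁻ i∈
                   in subst (_∈ diffSet S) (trans (negative-difference y i) (sym e)) (∈-diffSet⁺ S y (y + suc i) e₁ e₂)

  diffCard-present : ∀ x → at W x ≡ true → diffCard S ≡ suc (length present + length present)
  diffCard-present x ex = trans
    (↭-length (∼bag⇒↭ (unique∧set⇒bag (deduplicate-! _) differences-unique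
      (mk⇔ diffSet⊆differences (differences⊆diffSet x ex)))))
    (cong suc (trans (length-++ (map (pos ∘ suc) present))
      (cong₂ _+_ (length-map (pos ∘ suc) present) (length-map -[1+_] present))))

  present+missing⁺ : length present + missing⁺ W N ≡ N
  present+missing⁺ = trans (cong (length present +_) (missing⁺-differs W N lW))
    (length-filter-applyUpTo (λ i → differs (suc i) W) (λ i → i) N)

  missing≡2*missing⁺ : ∀ x → at W x ≡ true → missing S ≡ 2 * missing⁺ W N
  missing≡2*missing⁺ x ex = begin
    2 * suc N ∸ 1 ∸ diffCard S                 ≡⟨ cong₂ (λ N c → 2 * suc N ∸ 1 ∸ c) (sym present+missing⁺) (diffCard-present x ex) ⟩
    2 * suc (p + m) ∸ 1 ∸ suc (p + p)          ≡⟨ cong (λ k → k ∸ 1 ∸ suc (p + p)) (lemma p m) ⟩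
    suc (p + p) + 2 * m ∸ suc (p + p)          ≡⟨ m+n∸m≡n (suc (p + p)) (2 * m) ⟩
    2 * m                                      ∎
    where
    open ≡-Reasoning
    p = length present
    m = missing⁺ W N
    lemma : ∀ p m → 2 * suc (p + m) ≡ suc (suc (p + p) + 2 * m)
    lemma = solve-∀

-- The empty set and the parity of the number of missing differences

any-member : ∀ S → (∃[ x ] at S x ≡ true) ⊎ (∀ x → at S x ≡ false)
any-member []          = inj₂ λ _ → refl
any-member (true ∷ S)  = inj₁ (0 , refl)
any-member (false ∷ S) with any-member S
... | inj₁ (x , e) = inj₁ (suc x , e)
... | inj₂ none    = inj₂ λ { zero → refl ; (suc x) → none x }

missing⁺-empty : ∀ S N → (∀ x → at S x ≡ false) → missing⁺ S N ≡ N
missing⁺-empty S N none = misses-false 0 N λ i _ _ → absent i (conv S (reverse S) i) refl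
  where
  absent : ∀ i b → conv S (reverse S) i ≡ b → b ≡ false
  absent i false _ = refl
  absent i true  e = let x , _ , _ , ex , _ = conv⁻ S (reverse S) i e in trans (sym ex) (none x)

diffCard-empty : ∀ {n} (S : Subset n) → (∀ x → at (toList S) x ≡ false) → diffCard S ≡ 0
diffCard-empty S none = length≡0 (diffSet S) λ k∈ →
  let x , _ , _ , ex , _ = ∈-diffSet⁻ S k∈ in contradiction (trans (sym ex) (none x)) λ ()
  where
  length≡0 : ∀ (ks : List ℤ) → (∀ {k} → ¬ k ∈ ks) → length ks ≡ 0
  length≡0 []       ∉ks = refl
  length≡0 (k ∷ ks) ∉ks = contradiction (here refl) ∉ks

even-or-odd : ∀ k → (∃[ m ] k ≡ 2 * m) ⊎ (∃[ m ] k ≡ suc (2 * m))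
even-or-odd zero = inj₁ (0 , refl)
even-or-odd (suc k) with even-or-odd k
... | inj₁ (m , e) = inj₂ (m , cong suc e)
... | inj₂ (m , e) = inj₁ (suc m , trans (cong suc e) (sym (cong suc (+-suc m (m + 0)))))

module _ {N : ℕ} (2<N : 2 < N) where

  -- The empty set is exceptional because it lacks the difference 0 as well, which makes its number
  -- of missing differences odd.
  missing-cases : ∀ (S : Subset (suc N)) → missing S ≡ 2 * missing⁺ (toList S) N ⊎
                  (missing⁺ (toList S) N ≡ N × missing S ≡ suc (2 * N))
  missing-cases S with any-member (toList S)
  ... | inj₁ (x , ex) = inj₁ (missing≡2*missing⁺ S x ex)
  ... | inj₂ none     = inj₂ (missing⁺-empty (toList S) N none ,
    trans (cong (2 * suc N ∸ 1 ∸_) (diffCard-empty S none)) (+-suc N (N + 0)))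

  missing⁺≡2⇒ : ∀ (S : Subset (suc N)) → missing⁺ (toList S) N ≡ 2 → missing S ≡ 4
  missing⁺≡2⇒ S e with missing-cases S
  ... | inj₁ e₁       = trans e₁ (cong (2 *_) e)
  ... | inj₂ (e₁ , _) = contradiction (trans (sym e) e₁) (<⇒≢ 2<N)

  -- An even k belongs to m = k / 2. An odd k arises from the empty set alone, where `missing⁺` is
  -- N; as N > 2, this value also differs from 2 and the same comparison applies.
  missing≡k⇒ : ∀ k → k ≢ 4 → ∃[ m ] (m ≢ 2 × (∀ (S : Subset (suc N)) → missing S ≡ k → missing⁺ (toList S) N ≡ m))
  missing≡k⇒ k k≢4 with even-or-odd k
  ... | inj₁ (m , refl) = m , (λ { refl → k≢4 refl }) , go
    where
    go : ∀ S → missing S ≡ 2 * m → missing⁺ (toList S) N ≡ m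
    go S e with missing-cases S
    ... | inj₁ e₁       = *-cancelˡ-≡ _ _ 2 (trans (sym e₁) e)
    ... | inj₂ (_ , e₁) = contradiction (trans (sym e) e₁) (even≢odd m N)
  ... | inj₂ (m , refl) = N , (λ N≡2 → <⇒≢ 2<N (sym N≡2)) , go
    where
    go : ∀ S → missing S ≡ suc (2 * m) → missing⁺ (toList S) N ≡ N
    go S e with missing-cases S
    ... | inj₁ e₁       = contradiction (trans (sym e₁) e) (even≢odd (missing⁺ (toList S) N) m)
    ... | inj₂ (e₁ , _) = e₁

-- Choice of the parameters

≡⇒≡ᵇ-true : ∀ {m n} → m ≡ n → (m ≡ᵇ n) ≡ true
≡⇒≡ᵇ-true {zero}  refl = refl
≡⇒≡ᵇ-true {suc m} refl = ≡⇒≡ᵇ-true {m} refl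

≡ᵇ-true⇒≡ : ∀ m n → (m ≡ᵇ n) ≡ true → m ≡ n
≡ᵇ-true⇒≡ m n e = ≡ᵇ⇒≡ m n (subst T (sym e) _)

-- The constant is 128 = 8 · 4 · 4: the 8 of the error estimate, a 4 from b ≤ 4 g, and a 4 from 4 ^
-- g = 4 · 4 ^ h.
rescale : ∀ d x y w → x ≤ 4 * y → 128 * d * y < 4 * w → 8 * (d * x) < w
rescale d x y w x≤4y small = *-cancelˡ-< 4 _ _ (begin-strict
  4 * (8 * (d * x))         ≤⟨ *-monoʳ-≤ 4 (*-monoʳ-≤ 8 (*-monoʳ-≤ d x≤4y)) ⟩
  4 * (8 * (d * (4 * y)))   ≡⟨ lemma d y ⟩
  128 * d * y               <⟨ small ⟩
  4 * w                     ∎)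
  where
  open ≤-Reasoning
  lemma : ∀ d y → 4 * (8 * (d * (4 * y))) ≡ 128 * d * y
  lemma = solve-∀

-- The value g = 64 fixes the threshold for n: with n = 4 g + ρ and ρ < 4, g ≥ 64 amounts to n ≥
-- 256.
base-case : 128 * 2 ^ 12 * (64 * 3 ^ 64) < 4 ^ 64
base-case = <ᵇ⇒< (128 * 2 ^ 12 * (64 * 3 ^ 64)) (4 ^ 64) _

module _ (h ρ : ℕ) (63≤h : 63 ≤ h) (ρ<4 : ρ < 4) where
  open Count h ρ

  private
    2<N : 2 < g + b
    2<N = ≤-trans (≤-trans (m≤m+n 3 61) (s≤s 63≤h)) (m≤m+n g b)

    b≤4g : b ≤ 4 * g
    b≤4g = ≤-trans (+-monoʳ-≤ h (+-monoˡ-≤ L (s≤s⁻¹ ρ<4))) (≤-trans (m≤n+m _ h′) (≤-reflexive lemma′))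
      where
      h′ = h ∸ 1
      lemma : ∀ h → h + (1 + h + (3 + (suc (suc (1 + h)) + (1 + h)))) ≡ 4 * suc (1 + h)
      lemma = solve-∀
      lemma′ : h′ + (h + (3 + L)) ≡ 4 * g
      lemma′ = subst (λ k → h′ + (k + (3 + (suc (suc k) + k))) ≡ 4 * suc k) (m+[n∸m]≡n {1} (≤-trans (s≤s z≤n) 63≤h)) (lemma h′)

    small : 8 * (2 ^ 12 * (b * 3 ^ g)) < 4 ^ h
    small = rescale (2 ^ 12) (b * 3 ^ g) (g * 3 ^ g) (4 ^ h)
      (≤-trans (*-monoˡ-≤ (3 ^ g) b≤4g) (≤-reflexive (*-assoc 4 g (3 ^ g))))
      (linear*3^<4^ (128 * 2 ^ 12) 61 base-case g (s≤s 63≤h))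

  countM-4-largest : ∀ k → k ≢ 4 → countM n k < countM n 4
  countM-4-largest k k≢4 = let m , m≢2 , k⇒m = missing≡k⇒ 2<N k k≢4 in begin-strict
    countM n k     ≤⟨ count-≤-∑ n (λ S → missing S ≟ k) (λ W → μ W ≡ᵇ m) (λ S e → ≡⇒≡ᵇ-true (k⇒m S e)) ⟩
    occurrences m  <⟨ occurrences-< (≤-trans (m≤m+n 16 47) 63≤h) small m m≢2 ⟩
    occurrences 2  ≤⟨ ∑-≤-count n (λ S → missing S ≟ 4) (λ W → μ W ≡ᵇ 2) (λ S e → missing⁺≡2⇒ 2<N S (≡ᵇ-true⇒≡ _ 2 e)) ⟩
    countM n 4     ∎
    where open ≤-Reasoning

theorem1p2 : ∃[ N ] ∀ (n : ℕ) → n ≥ N → ∀ (k : ℕ) → k ≢ 4 → countM n 4 > countM n k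
theorem1p2 = 256 , λ n n≥256 → subst (λ n → ∀ k → k ≢ 4 → countM n 4 > countM n k) (size n n≥256)
  (countM-4-largest (n / 4 ∸ 1) (n % 4) (∸-monoˡ-≤ 1 (/-mono-≤ n≥256 ≤-refl)) (m%n<n n 4))
  where
  size : ∀ n → n ≥ 256 → Fringe.n (n / 4 ∸ 1) (n % 4) ≡ n
  size n n≥256 = trans (lemma (n / 4 ∸ 1) (n % 4)) (trans (cong (λ g → n % 4 + g * 4)
      (m+[n∸m]≡n {1} (≤-trans (s≤s z≤n) (/-mono-≤ n≥256 (≤-refl {4}))))) (sym (m≡m%n+[m/n]*n n 4)))
    where
    lemma : ∀ h ρ → suc (suc h + (h + (ρ + (suc (suc h) + h)))) ≡ ρ + suc h * 4
    lemma = solve-∀
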